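{- Let $n$ be a positive integer. Then in the ring $\mathbb{Z}[x,q]$ (polynomials in $x$ whose coefficients are polynomials in $q$; congruences are modulo the indicated polynomials in $q$, coefficientwise in $x$), the following hold: $$(1+q)^2\sum_{k=0}^{n-1}q^{2k}[k+1]_{q^2}\,g_k(x;q^2)\equiv \sum_{k=0}^{n-1}q^{2k}g_k(x;q^2)\pmod{\prod_{\substack{d\mid n\\ d>1\text{ odd}}}\Phi_d(q)},$$ $$\sum_{k=0}^{n-1}q^{k}g_k(x;q)\equiv 0\pmod{\prod_{\substack{d\mid n\\ d\text{ even}}}\Phi_d(q)},$$ $$\sum_{j=0}^{n-1}x^j[j+1]_{q^2}{2j\brack j}_q\sum_{k=j}^{n-1}q^k{k\brack j}_q{k+1\brack j+1}_q\equiv 0\pmod{\prod_{\substack{d\mid n\\ d>2\text{ even}}}\Phi_d(q)}.$$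
   Context: The $q$-binomial coefficients are ${n\brack k}_q=\prod_{i=1}^{k}\frac{1-q^{n-k+i}}{1-q^i}$ for $0\le k\le n$ and $0$ otherwise. The $q$-integer is $[n]_q=\frac{1-q^n}{1-q}$. $\Phi_d(q)$ denotes the $d$-th cyclotomic polynomial. The $q$-Sun polynomials are $g_n(x;q)=\sum_{k=0}^{n}{n\brack k}_q^2{2k\brack k}_q x^k$. An empty product of cyclotomic polynomials equals $1$. -}

module Defs where

open import Algebra.Bundles.Raw using (RawRing)
import Algebra.Definitions.RawSemiring as RawSemiringDefs
open import Data.Bool.Base using (if_then_else_)
open import Data.Fin.Base using (toℕ)
open import Data.Integer.Base as ℤ using (ℤ)
open import Data.List.Base using (List; []; _∷_; drop; filter; foldr; length; map; upTo)
open import Data.Nat.Base as ℕ using (ℕ; zero; suc; _∸_)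
open import Data.Nat.Divisibility using (_∣?_)
open import Data.Nat.Properties using (_≤?_; _<?_)
open import Function.Base using (_∘_)
open import Relation.Nullary.Decidable.Core using (does)

-- Univariate polynomials as coefficient lists, constant term first.
-- Trailing zeros are allowed, so equality is equality of all coefficients.

module Polynomial {c ℓ} (R : RawRing c ℓ) where

  private module R = RawRing R

  Poly : Set c
  Poly = List R.Carrier

  coeff : Poly → ℕ → R.Carrier
  coeff []      _       = R.0#
  coeff (a ∷ p) zero    = a
  coeff (a ∷ p) (suc i) = coeff p i

  infix  4 _≈ₚ_
  infixl 6 _+ₚ_
  infixl 7 _*ₚ_
  infixr 7 _•ₚ_

  _≈ₚ_ : Poly → Poly → Set ℓ
  p ≈ₚ r = ∀ i → coeff p i R.≈ coeff r i

  _+ₚ_ : Poly → Poly → Poly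
  []      +ₚ r       = r
  (a ∷ p) +ₚ []      = a ∷ p
  (a ∷ p) +ₚ (b ∷ r) = (a R.+ b) ∷ (p +ₚ r)

  _•ₚ_ : R.Carrier → Poly → Poly
  a •ₚ p = map (a R.*_) p

  _*ₚ_ : Poly → Poly → Poly
  []      *ₚ r = []
  (a ∷ p) *ₚ r = (a •ₚ r) +ₚ (R.0# ∷ (p *ₚ r))

  indeterminate : Poly
  indeterminate = R.0# ∷ R.1# ∷ []

  polynomialRawRing : RawRing c ℓ
  polynomialRawRing = record
    { Carrier = Poly
    ; _≈_     = _≈ₚ_
    ; _+_     = _+ₚ_
    ; _*_     = _*ₚ_
    ; -_      = map R.-_
    ; 0#      = []
    ; 1#      = R.1# ∷ []
    }

private module Pq = Polynomial ℤ.+-*-rawRing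

open RawRing Pq.polynomialRawRing public
  using (_≈_; _+_; _*_; -_; 0#; 1#)
  renaming (Carrier to ℤ[q]; rawSemiring to ℤ[q]-rawSemiring)
open RawSemiringDefs ℤ[q]-rawSemiring public
  using (_^_; _∣_; sum; product)

coeffq : ℤ[q] → ℕ → ℤ
coeffq = Pq.coeff

q : ℤ[q]
q = Pq.indeterminate

infixl 6 _-_
_-_ : ℤ[q] → ℤ[q] → ℤ[q]
p - r = p + (- r)

sumFromTo : ℕ → ℕ → (ℕ → ℤ[q]) → ℤ[q]
sumFromTo j n f = sum {n ∸ j} (λ i → f (j ℕ.+ toℕ i))

infix 5 sumFromTo
syntax sumFromTo j n (λ k → t) = ∑[ j ≤ k < n ] t

-- The quotient p / d, by long division from the constant term upwards.
-- It is only used when d divides p in ℤ[q] and d has constant coefficient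
-- d₀ = ±1; then d₀ is its own inverse, so c below is the constant coefficient
-- of p / d, and length p steps produce all coefficients of p / d.

divide : ℕ → ℤ[q] → ℤ[q] → ℤ[q]
divide zero       p d = []
divide (suc fuel) p d = c ∷ divide fuel (drop 1 (p - (c Pq.•ₚ d))) d
  where c = coeffq p 0 ℤ.* coeffq d 0

infixl 7 _÷_
_÷_ : ℤ[q] → ℤ[q] → ℤ[q]
p ÷ d = divide (length p) p d

-- q-analogues carry their base Q, since both q and q² occur.  The divisions
-- below have divisors with constant coefficient 1 when Q has constant
-- coefficient 0.

[_]⟨_⟩ : ℕ → ℤ[q] → ℤ[q]
[ n ]⟨ Q ⟩ = (1# - Q ^ n) ÷ (1# - Q)

[_choose_]⟨_⟩ : ℕ → ℕ → ℤ[q] → ℤ[q]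
[ n choose k ]⟨ Q ⟩ =
  if does (k ≤? n)
  then product {k} (λ i → 1# - Q ^ ((n ∸ k) ℕ.+ suc (toℕ i)))
       ÷ product {k} (λ i → 1# - Q ^ suc (toℕ i))
  else 0#

divisors : ℕ → List ℕ
divisors n = filter (_∣? n) (map suc (upTo n))

-- Φ d = (q ^ d - 1) / ∏ Φ e over the proper divisors e of d.  The fuel argument
-- only serves termination: every proper divisor e of d is below d, so fuel d
-- suffices.  The constant coefficients are -1 for d = 1 and 1 for d > 1.

cyclotomic : ℕ → ℕ → ℤ[q]
cyclotomic zero       d = 1#
cyclotomic (suc fuel) d =
  (q ^ d - 1#)
  ÷ foldr _*_ 1# (map (cyclotomic fuel) (filter (_<? d) (divisors d)))

Φ : ℕ → ℤ[q]
Φ d = cyclotomic d d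

∏Φ : List ℕ → ℤ[q]
∏Φ ds = foldr _*_ 1# (map Φ ds)

-- ℤ[x,q] is ℤ[q][x], so coeffx gives coefficients in ℤ[q].

private module Px = Polynomial Pq.polynomialRawRing

open RawRing Px.polynomialRawRing public
  using ()
  renaming (Carrier to ℤ[x,q]; _≈_ to _≈ₓ_; _+_ to _+ₓ_; _*_ to _*ₓ_; -_ to -ₓ_;
            0# to 0ₓ; 1# to 1ₓ; rawSemiring to ℤ[x,q]-rawSemiring)
open RawSemiringDefs ℤ[x,q]-rawSemiring public
  using ()
  renaming (_^_ to _^ₓ_; sum to sumₓ)

coeffx : ℤ[x,q] → ℕ → ℤ[q]
coeffx = Px.coeff

x : ℤ[x,q]
x = Px.indeterminate

infixr 7 _•_
_•_ : ℤ[q] → ℤ[x,q] → ℤ[x,q]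
_•_ = Px._•ₚ_

sumBelow : ℕ → (ℕ → ℤ[x,q]) → ℤ[x,q]
sumBelow n f = sumₓ {n} (f ∘ toℕ)

infix 5 sumBelow
syntax sumBelow n (λ k → t) = ∑ₓ[ k < n ] t

infix 4 _≡_mod_
_≡_mod_ : ℤ[x,q] → ℤ[x,q] → ℤ[q] → Set
F ≡ G mod m = ∀ i → m ∣ coeffx (F +ₓ (-ₓ G)) i

g : ℕ → ℤ[q] → ℤ[x,q]
g n Q =
  ∑ₓ[ k < suc n ] ([ n choose k ]⟨ Q ⟩ ^ 2 * [ 2 ℕ.* k choose k ]⟨ Q ⟩) • x ^ₓ k

{-# OPTIONS --safe #-}

-- Fix d > 1 and work modulo Φ d, where q is a primitive d-th root of unity ζ and every 1 - ζ ^ i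
-- with d ∤ i is cancellable.  Up to a cancellable factor, the Gaussian binomial [k choose j] is
-- ∏ (ζ ^ i - z) over i < j, evaluated at z = ζ ^ k.  The sum of z ^ e over all d-th roots of unity z
-- vanishes for 0 < e < d, so the sums of z [k choose j]² and z² [k choose j]² over a period
-- vanish for 2 j + 1 < d and 2 j + 2 < d; for 2 j + 1 = d the two top coefficients of the
-- polynomial relate these sums.  The q-Lucas theorem reduces all k and j to one period, and kills
-- [2 j choose j] in the remaining case 2 j ≥ d.
--
-- Products of distinct Φ d are handled without irreducibility or Gauss's lemma: if d ∤ i then
-- q ^ i - 1 is cancellable modulo Φ d, since with g = gcd (i, d) the quotient
-- (q ^ d - 1) / (q ^ g - 1) is divisible by Φ d and is congruent to the integer d / g modulo
-- q ^ g - 1, and integers are cancellable modulo any polynomial with constant coefficient ±1.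

module Submission where

open import Algebra.Bundles using (CommutativeRing)
import Algebra.Properties.Ring as RingProperties
import Algebra.Properties.Semiring.Divisibility as SemiringDivisibility
import Algebra.Properties.Semiring.Exp as SemiringExp
import Algebra.Properties.Semiring.Mult.TCOptimised as SemiringMult
import Algebra.Solver.Ring as RingSolver
open import Algebra.Solver.Ring.AlmostCommutativeRing
  using (fromCommutativeRing; _-Raw-AlmostCommutative⟶_)
open import Algebra.Structures using (IsCommutativeRing)
open import Data.Fin.Base using (toℕ)
open import Data.Integer.Base as ℤ using (ℤ; -[1+_])
import Data.Integer.Properties as ℤ
open import Data.List.Base
  using (List; []; _∷_; _++_; drop; filter; foldr; length; map; upTo)
open import Data.List.Membership.Propositional using (_∈_)
open import Data.List.Membership.Propositional.Properties using (∈-filter⁺; ∈-map⁺; ∈-upTo⁺)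
import Data.List.Properties as List
open import Data.List.Relation.Unary.All as All using (All; []; _∷_)
import Data.List.Relation.Unary.All.Properties as All
open import Data.List.Relation.Unary.AllPairs using (AllPairs; []; _∷_)
import Data.List.Relation.Unary.AllPairs.Properties as AllPairs
open import Data.List.Relation.Unary.Any using (here; there)
open import Data.Maybe.Base as Maybe using (Maybe)
open import Data.Nat.Base as ℕ using (ℕ; zero; suc; NonZero)
open import Data.Nat.Divisibility using (_∣?_)
import Data.Nat.Divisibility as ℕ
open import Data.Nat.DivMod using (_/_; _%_; m≡m%n+[m/n]*n; m%n<n)
open import Data.Nat.GCD using (gcd; gcd[m,n]∣m; gcd[m,n]∣n; gcd-GCD; module Bézout)
open import Data.Nat.Induction using (<-rec)
open import Data.Nat.Properties using (_<?_)
import Data.Nat.Properties as ℕ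
open import Data.Nat.Solver using (module +-*-Solver)
open import Data.Product.Base as Σ using (∃; _×_; proj₁; proj₂)
open import Data.Sum.Base using (_⊎_; inj₁; inj₂)
import Data.Vec.Functional as Vector
open import Defs using (module Polynomial; ℤ[q]; coeffq; divide; _÷_; divisors)
open import Function.Base using (id)
open import Level using (0ℓ; _⊔_)
open import Relation.Binary.Definitions using (tri<; tri≈; tri>)
open import Relation.Binary.PropositionalEquality as ≡ using (_≡_; _≢_)
import Relation.Binary.Reasoning.Setoid as SetoidReasoning
open import Relation.Nullary.Decidable
  using (yes; no; dec⇒maybe; dec-true; dec-false; _×-dec_; ¬?)
open import Relation.Nullary.Negation.Core using (¬_; contradiction)
open import Relation.Unary using (Decidable)

-- Commutative rings

-- The coefficient of x ^ j depends on two moments only: M₁ and M₂, the sums of z [k choose j]² and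
-- z² [k choose j]² over z = ζ ^ k. Up to cancellable factors, the q-integer [k + 1] and, by
-- absorption, the factor [k + 1 choose j + 1] both contribute 1 - ζ z; this is why exponent 2
-- occurs and no higher one. Up to factors outside the sum over k, the second congruence is about
-- M₁, the third about M₁ - ζ M₂ divided by 1 - ζ ^ (j + 1), and the first compares M₁ with M₁ - ζ
-- M₂ divided by 1 - ζ. The parity of d decides which boundary case can occur. Let b be the
-- remainder of j modulo d. If 2 b + 2 = d, then d is even; M₁ still vanishes, M₂ need not, and the
-- third congruence is rescued by its factor [j + 1] in base q ^ 2, which vanishes once 1 - q ^ 2 is
-- cancellable, hence the condition d > 2. If 2 b + 1 = d, then d is odd; neither moment need
-- vanish, and (1 + q) ^ 2 is the weight that turns their relation into the first congruence. In
-- that congruence ζ is q ^ 2, for which cancellability survives because d is odd.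

module IntegerCoefficientSolver {c ℓ} (R : CommutativeRing c ℓ) where

  open CommutativeRing R
  open RingProperties ring
    using (-0#≈0#; -‿involutive; -‿distribˡ-*; -‿distribʳ-*; -‿+-comm)
  open SemiringMult semiring using (1+×; ×-homo-+; ×1-homo-*) renaming (_×_ to _·_)
  open SetoidReasoning setoid

  ⟦_⟧ : ℤ → Carrier
  ⟦ ℤ.+ n ⟧    = n · 1#
  ⟦ -[1+ n ] ⟧ = - (suc n · 1#)

  private

    neg-homo : ∀ i → ⟦ ℤ.- i ⟧ ≈ - ⟦ i ⟧
    neg-homo (ℤ.+ zero)  = sym -0#≈0#
    neg-homo (ℤ.+ suc n) = refl
    neg-homo -[1+ n ]    = sym (-‿involutive _)

    cancel-both : ∀ a b c → (a + b) + - (a + c) ≈ b + - c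
    cancel-both a b c = begin
      (a + b) + - (a + c)      ≈⟨ +-cong (+-comm a b) (sym (-‿+-comm a c)) ⟩
      (b + a) + (- a + - c)    ≈⟨ +-assoc b a _ ⟩
      b + (a + (- a + - c))    ≈⟨ +-congˡ (+-assoc a (- a) (- c)) ⟨
      b + ((a + - a) + - c)    ≈⟨ +-congˡ (+-congʳ (-‿inverseʳ a)) ⟩
      b + (0# + - c)           ≈⟨ +-congˡ (+-identityˡ _) ⟩
      b + - c                  ∎

    ⊖-homo : ∀ m n → ⟦ m ℤ.⊖ n ⟧ ≈ m · 1# + - (n · 1#)
    ⊖-homo m zero = sym (trans (+-congˡ -0#≈0#) (+-identityʳ _))
    ⊖-homo zero (suc n) = sym (+-identityˡ _)
    ⊖-homo (suc m) (suc n) = begin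
      ⟦ suc m ℤ.⊖ suc n ⟧                  ≡⟨ ≡.cong ⟦_⟧ (ℤ.[1+m]⊖[1+n]≡m⊖n m n) ⟩
      ⟦ m ℤ.⊖ n ⟧                          ≈⟨ ⊖-homo m n ⟩
      m · 1# + - (n · 1#)                  ≈⟨ cancel-both 1# (m · 1#) (n · 1#) ⟨
      (1# + m · 1#) + - (1# + n · 1#)      ≈⟨ +-cong (1+× m 1#) (-‿cong (1+× n 1#)) ⟨
      suc m · 1# + - (suc n · 1#)          ∎

    +-homo : ∀ i j → ⟦ i ℤ.+ j ⟧ ≈ ⟦ i ⟧ + ⟦ j ⟧
    +-homo (ℤ.+ m)  (ℤ.+ n)  = ×-homo-+ 1# m n
    +-homo (ℤ.+ m)  -[1+ n ] = ⊖-homo m (suc n)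
    +-homo -[1+ m ] (ℤ.+ n)  = trans (⊖-homo n (suc m)) (+-comm _ _)
    +-homo -[1+ m ] -[1+ n ] = begin
      - (suc (suc (m ℕ.+ n)) · 1#)      ≡⟨ ≡.cong (λ k → - (suc k · 1#)) (ℕ.+-suc m n) ⟨
      - ((suc m ℕ.+ suc n) · 1#)        ≈⟨ -‿cong (×-homo-+ 1# (suc m) (suc n)) ⟩
      - (suc m · 1# + suc n · 1#)       ≈⟨ -‿+-comm _ _ ⟨
      - (suc m · 1#) + - (suc n · 1#)   ∎

    pos-*-homo : ∀ m n → ⟦ ℤ.+ m ℤ.* ℤ.+ n ⟧ ≈ m · 1# * n · 1#
    pos-*-homo m n = trans (reflexive (≡.cong ⟦_⟧ (≡.sym (ℤ.pos-* m n)))) (×1-homo-* m n)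

    pos-*-homoʳ : ∀ m j → ⟦ ℤ.+ m ℤ.* j ⟧ ≈ m · 1# * ⟦ j ⟧
    pos-*-homoʳ m (ℤ.+ n)  = pos-*-homo m n
    pos-*-homoʳ m -[1+ n ] = begin
      ⟦ ℤ.+ m ℤ.* ℤ.- ℤ.+ suc n ⟧      ≡⟨ ≡.cong ⟦_⟧ (ℤ.neg-distribʳ-* (ℤ.+ m) (ℤ.+ suc n)) ⟨
      ⟦ ℤ.- (ℤ.+ m ℤ.* ℤ.+ suc n) ⟧    ≈⟨ neg-homo (ℤ.+ m ℤ.* ℤ.+ suc n) ⟩
      - ⟦ ℤ.+ m ℤ.* ℤ.+ suc n ⟧        ≈⟨ -‿cong (pos-*-homo m (suc n)) ⟩
      - (m · 1# * suc n · 1#)          ≈⟨ -‿distribʳ-* _ _ ⟩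
      m · 1# * - (suc n · 1#)          ∎

    *-homo : ∀ i j → ⟦ i ℤ.* j ⟧ ≈ ⟦ i ⟧ * ⟦ j ⟧
    *-homo (ℤ.+ m)  j = pos-*-homoʳ m j
    *-homo -[1+ m ] j = begin
      ⟦ ℤ.- ℤ.+ suc m ℤ.* j ⟧      ≡⟨ ≡.cong ⟦_⟧ (ℤ.neg-distribˡ-* (ℤ.+ suc m) j) ⟨
      ⟦ ℤ.- (ℤ.+ suc m ℤ.* j) ⟧    ≈⟨ neg-homo (ℤ.+ suc m ℤ.* j) ⟩
      - ⟦ ℤ.+ suc m ℤ.* j ⟧        ≈⟨ -‿cong (pos-*-homoʳ (suc m) j) ⟩
      - (suc m · 1# * ⟦ j ⟧)       ≈⟨ -‿distribˡ-* _ _ ⟩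
      - (suc m · 1#) * ⟦ j ⟧       ∎

    morphism : ℤ.+-*-rawRing -Raw-AlmostCommutative⟶ fromCommutativeRing R
    morphism = record
      { ⟦_⟧    = ⟦_⟧
      ; +-homo = +-homo
      ; *-homo = *-homo
      ; -‿homo = neg-homo
      ; 0-homo = refl
      ; 1-homo = refl
      }

    -- Only coefficients are ever compared. Taking them in ℤ makes the solver available in every
    -- commutative ring, including quotients whose equality comes without a decision procedure.
    _≟_ : ∀ i j → Maybe (⟦ i ⟧ ≈ ⟦ j ⟧)
    i ≟ j = Maybe.map (λ i≡j → reflexive (≡.cong ⟦_⟧ i≡j)) (dec⇒maybe (i ℤ.≟ j))

  open RingSolver ℤ.+-*-rawRing (fromCommutativeRing R) morphism _≟_ public
    using (solve; _:=_; _:+_; _:*_; _:-_; :-_; con)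

  :1 : ∀ {n} → RingSolver.Polynomial ℤ.+-*-rawRing (fromCommutativeRing R) morphism _≟_ n
  :1 = con ℤ.1ℤ

-- Indexing by ℕ keeps shifts and splittings of the range free of `Fin` arithmetic. The operation is
-- a parameter because both `∑` and the products in the Gaussian binomials are instances.
sumTo : ∀ {a} {A : Set a} → (A → A → A) → A → ℕ → (ℕ → A) → A
sumTo _+_ z zero    f = z
sumTo _+_ z (suc n) f = f 0 + sumTo _+_ z n (λ k → f (suc k))

sumTo≡foldr : ∀ {a} {A : Set a} (_+_ : A → A → A) z n f →
              sumTo _+_ z n f ≡ Vector.foldr _+_ z {n} (λ i → f (toℕ i))
sumTo≡foldr _+_ z zero    f = ≡.refl
sumTo≡foldr _+_ z (suc n) f = ≡.cong (f 0 +_) (sumTo≡foldr _+_ z n (λ k → f (suc k)))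

module FiniteSums {c ℓ} (R : CommutativeRing c ℓ) where

  open CommutativeRing R
  open IntegerCoefficientSolver R
  open SemiringExp semiring using (_^_)
  open SetoidReasoning setoid

  ∑ : ℕ → (ℕ → Carrier) → Carrier
  ∑ = sumTo _+_ 0#

  ∑-cong : ∀ n {f h} → (∀ k → k ℕ.< n → f k ≈ h k) → ∑ n f ≈ ∑ n h
  ∑-cong zero    f≈h = refl
  ∑-cong (suc n) f≈h =
    +-cong (f≈h 0 (ℕ.s≤s ℕ.z≤n)) (∑-cong n (λ k k<n → f≈h (suc k) (ℕ.s≤s k<n)))

  ∑-zero : ∀ n {f} → (∀ k → k ℕ.< n → f k ≈ 0#) → ∑ n f ≈ 0#
  ∑-zero zero    f≈0 = refl
  ∑-zero (suc n) f≈0 = trans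
    (+-cong (f≈0 0 (ℕ.s≤s ℕ.z≤n)) (∑-zero n (λ k k<n → f≈0 (suc k) (ℕ.s≤s k<n))))
    (+-identityˡ 0#)

  ∑-++ : ∀ m n f → ∑ (m ℕ.+ n) f ≈ ∑ m f + ∑ n (λ k → f (m ℕ.+ k))
  ∑-++ zero    n f = sym (+-identityˡ _)
  ∑-++ (suc m) n f =
    trans (+-congˡ (∑-++ m n (λ k → f (suc k)))) (sym (+-assoc _ _ _))

  ∑-distrib-+ : ∀ n f h → ∑ n (λ k → f k + h k) ≈ ∑ n f + ∑ n h
  ∑-distrib-+ zero    f h = sym (+-identityˡ 0#)
  ∑-distrib-+ (suc n) f h = trans
    (+-congˡ (∑-distrib-+ n (λ k → f (suc k)) (λ k → h (suc k))))
    (solve 4 (λ a b s t → (a :+ b) :+ (s :+ t) := (a :+ s) :+ (b :+ t)) refl _ _ _ _)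

  *-distribˡ-∑ : ∀ n a f → a * ∑ n f ≈ ∑ n (λ k → a * f k)
  *-distribˡ-∑ zero    a f = zeroʳ a
  *-distribˡ-∑ (suc n) a f =
    trans (distribˡ a _ _) (+-congˡ (*-distribˡ-∑ n a (λ k → f (suc k))))

  -- The Kronecker delta, serving as the coefficient of x ^ i in x ^ k.
  δ : ℕ → ℕ → Carrier
  δ zero    zero    = 1#
  δ zero    (suc i) = 0#
  δ (suc k) zero    = 0#
  δ (suc k) (suc i) = δ k i

  ∑-δ-≥ : ∀ n i f → n ℕ.≤ i → ∑ n (λ k → f k * δ k i) ≈ 0#
  ∑-δ-≥ zero    i       f _           = refl
  ∑-δ-≥ (suc n) (suc i) f (ℕ.s≤s n≤i) =
    trans (+-cong (zeroʳ _) (∑-δ-≥ n i (λ k → f (suc k)) n≤i)) (+-identityˡ 0#)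

  ∑-δ-< : ∀ n i f → i ℕ.< n → ∑ n (λ k → f k * δ k i) ≈ f i
  ∑-δ-< (suc n) zero    f _           =
    trans (+-cong (*-identityʳ _) (∑-zero n (λ k _ → zeroʳ _))) (+-identityʳ _)
  ∑-δ-< (suc n) (suc i) f (ℕ.s≤s i<n) =
    trans (+-cong (zeroʳ _) (∑-δ-< n i (λ k → f (suc k)) i<n)) (+-identityˡ _)

  ∑-leading-zeros : ∀ m n f → (∀ k → k ℕ.< m → f k ≈ 0#) → ∑ (m ℕ.+ n) f ≈ ∑ n (λ k → f (m ℕ.+ k))
  ∑-leading-zeros m n f f≈0 = trans (∑-++ m n f) (trans (+-congʳ (∑-zero m f≈0)) (+-identityˡ _))

  -- Kept in multiplied form because 1 - a may be a zero divisor.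
  geometric-sum : ∀ n a → (1# - a) * ∑ n (λ k → a ^ k) ≈ 1# - a ^ n
  geometric-sum zero    a = trans (zeroʳ _) (sym (-‿inverseʳ 1#))
  geometric-sum (suc n) a = begin
    (1# - a) * (1# + ∑ n (λ k → a * a ^ k))    ≈⟨ *-congˡ (+-congˡ (*-distribˡ-∑ n a (a ^_))) ⟨
    (1# - a) * (1# + a * S)
      ≈⟨ solve 2 (λ a s → (:1 :- a) :* (:1 :+ a :* s) := :1 :- a :+ a :* ((:1 :- a) :* s)) refl a S ⟩
    1# - a + a * ((1# - a) * S)                ≈⟨ +-congˡ (*-congˡ (geometric-sum n a)) ⟩
    1# - a + a * (1# - a ^ n)
      ≈⟨ solve 2 (λ a p → :1 :- a :+ a :* (:1 :- p) := :1 :- a :* p) refl a (a ^ n) ⟩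
    1# - a * a ^ n                             ∎
    where S = ∑ n (a ^_)

-- Quotients by a principal ideal

module Quotient {c ℓ} (R : CommutativeRing c ℓ) (m : CommutativeRing.Carrier R) where

  open CommutativeRing R
  open IntegerCoefficientSolver R
  open SetoidReasoning setoid
  open SemiringDivisibility semiring using (_∣_; _,_)

  infix 4 _≋_
  _≋_ : Carrier → Carrier → Set (c ⊔ ℓ)
  a ≋ b = m ∣ (a - b)

  ≈⇒≋ : ∀ {a b} → a ≈ b → a ≋ b
  ≈⇒≋ {a} {b} a≈b = 0# , (begin
    0# * m    ≈⟨ zeroˡ m ⟩
    0#        ≈⟨ -‿inverseʳ b ⟨
    b - b     ≈⟨ +-congʳ a≈b ⟨
    a - b     ∎)

  ∣⇒≋0 : ∀ {a} → m ∣ a → a ≋ 0#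
  ∣⇒≋0 {a} (u , um≈a) = u , trans um≈a (solve 1 (λ a → a := a :- con ℤ.0ℤ) refl a)

  ≋0⇒∣ : ∀ {a} → a ≋ 0# → m ∣ a
  ≋0⇒∣ {a} (u , um≈a-0) = u , trans um≈a-0 (solve 1 (λ a → a :- con ℤ.0ℤ := a) refl a)

  private

    ≋-sym : ∀ {a b} → a ≋ b → b ≋ a
    ≋-sym {a} {b} (u , e) = - u , (begin
      - u * m      ≈⟨ solve 2 (λ u m → :- u :* m := :- (u :* m)) refl u m ⟩
      - (u * m)    ≈⟨ -‿cong e ⟩
      - (a - b)    ≈⟨ solve 2 (λ a b → :- (a :- b) := b :- a) refl a b ⟩
      b - a        ∎)

    ≋-trans : ∀ {a b d} → a ≋ b → b ≋ d → a ≋ d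
    ≋-trans {a} {b} {d} (u , e) (v , f) = u + v , (begin
      (u + v) * m          ≈⟨ distribʳ m u v ⟩
      u * m + v * m        ≈⟨ +-cong e f ⟩
      (a - b) + (b - d)    ≈⟨ solve 3 (λ a b d → (a :- b) :+ (b :- d) := a :- d) refl a b d ⟩
      a - d                ∎)

    +-cong-≋ : ∀ {a b s t} → a ≋ b → s ≋ t → a + s ≋ b + t
    +-cong-≋ {a} {b} {s} {t} (u , e) (v , f) = u + v , (begin
      (u + v) * m          ≈⟨ distribʳ m u v ⟩
      u * m + v * m        ≈⟨ +-cong e f ⟩
      (a - b) + (s - t)    ≈⟨ solve 4 (λ a b s t → (a :- b) :+ (s :- t) := (a :+ s) :- (b :+ t)) refl a b s t ⟩
      (a + s) - (b + t)    ∎)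

    *-cong-≋ : ∀ {a b s t} → a ≋ b → s ≋ t → a * s ≋ b * t
    *-cong-≋ {a} {b} {s} {t} (u , e) (v , f) = u * s + b * v , (begin
      (u * s + b * v) * m
        ≈⟨ solve 5 (λ u s b v m → (u :* s :+ b :* v) :* m := (u :* m) :* s :+ b :* (v :* m)) refl u s b v m ⟩
      (u * m) * s + b * (v * m)      ≈⟨ +-cong (*-congʳ e) (*-congˡ f) ⟩
      (a - b) * s + b * (s - t)
        ≈⟨ solve 4 (λ a b s t → (a :- b) :* s :+ b :* (s :- t) := a :* s :- b :* t) refl a b s t ⟩
      a * s - b * t                  ∎)

    neg-cong-≋ : ∀ {a b} → a ≋ b → - a ≋ - b
    neg-cong-≋ {a} {b} (u , e) = - u , (begin
      - u * m      ≈⟨ solve 2 (λ u m → :- u :* m := :- (u :* m)) refl u m ⟩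
      - (u * m)    ≈⟨ -‿cong e ⟩
      - (a - b)    ≈⟨ solve 2 (λ a b → :- (a :- b) := :- a :- :- b) refl a b ⟩
      - a - - b    ∎)

  -- The carrier and the operations are those of R and only the equality is coarser, so whatever
  -- holds in all commutative rings, the solver included, yields congruences directly.
  quotientRing : CommutativeRing c (c ⊔ ℓ)
  quotientRing = record
    { Carrier = Carrier
    ; _≈_     = _≋_
    ; _+_     = _+_
    ; _*_     = _*_
    ; -_      = -_
    ; 0#      = 0#
    ; 1#      = 1#
    ; isCommutativeRing = record
      { isRing = record
        { +-isAbelianGroup = record
          { isGroup = record
            { isMonoid = record
              { isSemigroup = record
                { isMagma = record
                  { isEquivalence = record
                    { refl  = ≈⇒≋ refl
                    ; sym   = ≋-sym
                    ; trans = ≋-trans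
                    }
                  ; ∙-cong = +-cong-≋
                  }
                ; assoc = λ a b d → ≈⇒≋ (+-assoc a b d)
                }
              ; identity = (λ a → ≈⇒≋ (+-identityˡ a)) Σ., (λ a → ≈⇒≋ (+-identityʳ a))
              }
            ; inverse = (λ a → ≈⇒≋ (-‿inverseˡ a)) Σ., (λ a → ≈⇒≋ (-‿inverseʳ a))
            ; ⁻¹-cong = neg-cong-≋
            }
          ; comm = λ a b → ≈⇒≋ (+-comm a b)
          }
        ; *-cong     = *-cong-≋
        ; *-assoc    = λ a b d → ≈⇒≋ (*-assoc a b d)
        ; *-identity = (λ a → ≈⇒≋ (*-identityˡ a)) Σ., (λ a → ≈⇒≋ (*-identityʳ a))
        ; distrib    = (λ a b d → ≈⇒≋ (distribˡ a b d)) Σ., (λ a b d → ≈⇒≋ (distribʳ a b d))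
        }
      ; *-comm = λ a b → ≈⇒≋ (*-comm a b)
      }
    }

-- Polynomials

module PolynomialRing {c ℓ} (R : CommutativeRing c ℓ) where

  open CommutativeRing R
  open IntegerCoefficientSolver R
  open SetoidReasoning setoid
  open Polynomial rawRing public

  coeff-+ : ∀ p r i → coeff (p +ₚ r) i ≈ coeff p i + coeff r i
  coeff-+ []      r       i       = sym (+-identityˡ _)
  coeff-+ (a ∷ p) []      i       = sym (+-identityʳ _)
  coeff-+ (a ∷ p) (b ∷ r) zero    = refl
  coeff-+ (a ∷ p) (b ∷ r) (suc i) = coeff-+ p r i

  coeff-neg : ∀ p i → coeff (map -_ p) i ≈ - coeff p i
  coeff-neg []      i       = sym -0#≈0#
    where open RingProperties ring
  coeff-neg (a ∷ p) zero    = refl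
  coeff-neg (a ∷ p) (suc i) = coeff-neg p i

  coeff-• : ∀ a p i → coeff (a •ₚ p) i ≈ a * coeff p i
  coeff-• a []      i       = sym (zeroʳ a)
  coeff-• a (b ∷ p) zero    = refl
  coeff-• a (b ∷ p) (suc i) = coeff-• a p i

  coeff-drop : ∀ p i → coeff (drop 1 p) i ≈ coeff p (suc i)
  coeff-drop []      i = refl
  coeff-drop (a ∷ p) i = refl

  coeff-∷-* : ∀ a p r i →
              coeff ((a ∷ p) *ₚ r) i ≈ a * coeff r i + coeff (0# ∷ (p *ₚ r)) i
  coeff-∷-* a p r i = trans (coeff-+ (a •ₚ r) _ i) (+-congʳ (coeff-• a r i))

  coeff-*-zero : ∀ p r → coeff (p *ₚ r) 0 ≈ coeff p 0 * coeff r 0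
  coeff-*-zero []      r = sym (zeroˡ _)
  coeff-*-zero (a ∷ p) r = trans (coeff-∷-* a p r 0) (+-identityʳ _)

  ∷-cong : ∀ {a b p r} → a ≈ b → p ≈ₚ r → (a ∷ p) ≈ₚ (b ∷ r)
  ∷-cong a≈b p≈r zero    = a≈b
  ∷-cong a≈b p≈r (suc i) = p≈r i

  +ₚ-cong : ∀ p p′ r r′ → p ≈ₚ p′ → r ≈ₚ r′ → (p +ₚ r) ≈ₚ (p′ +ₚ r′)
  +ₚ-cong p p′ r r′ p≈p′ r≈r′ i = begin
    coeff (p +ₚ r) i           ≈⟨ coeff-+ p r i ⟩
    coeff p i + coeff r i      ≈⟨ +-cong (p≈p′ i) (r≈r′ i) ⟩
    coeff p′ i + coeff r′ i    ≈⟨ coeff-+ p′ r′ i ⟨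
    coeff (p′ +ₚ r′) i         ∎

  +ₚ-assoc : ∀ p r s → ((p +ₚ r) +ₚ s) ≈ₚ (p +ₚ (r +ₚ s))
  +ₚ-assoc p r s i = begin
    coeff ((p +ₚ r) +ₚ s) i                  ≈⟨ coeff-+ (p +ₚ r) s i ⟩
    coeff (p +ₚ r) i + coeff s i             ≈⟨ +-congʳ (coeff-+ p r i) ⟩
    coeff p i + coeff r i + coeff s i        ≈⟨ +-assoc _ _ _ ⟩
    coeff p i + (coeff r i + coeff s i)      ≈⟨ +-congˡ (coeff-+ r s i) ⟨
    coeff p i + coeff (r +ₚ s) i             ≈⟨ coeff-+ p (r +ₚ s) i ⟨
    coeff (p +ₚ (r +ₚ s)) i                  ∎

  +ₚ-comm : ∀ p r → (p +ₚ r) ≈ₚ (r +ₚ p)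
  +ₚ-comm p r i = trans (coeff-+ p r i) (trans (+-comm _ _) (sym (coeff-+ r p i)))

  +ₚ-identityʳ : ∀ p → (p +ₚ []) ≈ₚ p
  +ₚ-identityʳ p i = trans (coeff-+ p [] i) (+-identityʳ _)

  -ₚ-cong : ∀ p r → p ≈ₚ r → map -_ p ≈ₚ map -_ r
  -ₚ-cong p r p≈r i = trans (coeff-neg p i) (trans (-‿cong (p≈r i)) (sym (coeff-neg r i)))

  +ₚ-inverseʳ : ∀ p → (p +ₚ map -_ p) ≈ₚ []
  +ₚ-inverseʳ p i =
    trans (coeff-+ p _ i) (trans (+-congˡ (coeff-neg p i)) (-‿inverseʳ _))

  *ₚ-zeroʳ : ∀ p → (p *ₚ []) ≈ₚ []
  *ₚ-zeroʳ []      i       = refl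
  *ₚ-zeroʳ (a ∷ p) zero    = refl
  *ₚ-zeroʳ (a ∷ p) (suc i) = *ₚ-zeroʳ p i

  *ₚ-congˡ : ∀ p r s → r ≈ₚ s → (p *ₚ r) ≈ₚ (p *ₚ s)
  *ₚ-congˡ []      r s r≈s i = refl
  *ₚ-congˡ (a ∷ p) r s r≈s i = begin
    coeff ((a ∷ p) *ₚ r) i                     ≈⟨ coeff-∷-* a p r i ⟩
    a * coeff r i + coeff (0# ∷ (p *ₚ r)) i
      ≈⟨ +-cong (*-congˡ (r≈s i)) (∷-cong {p = p *ₚ r} {p *ₚ s} refl (*ₚ-congˡ p r s r≈s) i) ⟩
    a * coeff s i + coeff (0# ∷ (p *ₚ s)) i    ≈⟨ coeff-∷-* a p s i ⟨
    coeff ((a ∷ p) *ₚ s) i                     ∎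

  -- Multiplication recurses on its left factor; this is the mirror recursion on the right factor,
  -- which makes commutativity a plain induction.
  *ₚ-∷ʳ : ∀ p b r i →
          coeff (p *ₚ (b ∷ r)) i ≈ b * coeff p i + coeff (0# ∷ (p *ₚ r)) i
  *ₚ-∷ʳ []      b r zero    = sym (trans (+-identityʳ _) (zeroʳ b))
  *ₚ-∷ʳ []      b r (suc i) = sym (trans (+-identityʳ _) (zeroʳ b))
  *ₚ-∷ʳ (a ∷ p) b r zero    = +-congʳ (*-comm a b)
  *ₚ-∷ʳ (a ∷ p) b r (suc i) = begin
    coeff ((a ∷ p) *ₚ (b ∷ r)) (suc i)                                     ≈⟨ coeff-∷-* a p (b ∷ r) (suc i) ⟩
    a * coeff r i + coeff (p *ₚ (b ∷ r)) i                                 ≈⟨ +-congˡ (*ₚ-∷ʳ p b r i) ⟩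
    a * coeff r i + (b * coeff p i + coeff (0# ∷ (p *ₚ r)) i)
      ≈⟨ solve 3 (λ x y z → x :+ (y :+ z) := y :+ (x :+ z)) refl _ _ _ ⟩
    b * coeff p i + (a * coeff r i + coeff (0# ∷ (p *ₚ r)) i)              ≈⟨ +-congˡ (coeff-∷-* a p r i) ⟨
    b * coeff p i + coeff ((a ∷ p) *ₚ r) i                                 ∎

  *ₚ-comm : ∀ p r → (p *ₚ r) ≈ₚ (r *ₚ p)
  *ₚ-comm []      r i = sym (*ₚ-zeroʳ r i)
  *ₚ-comm (a ∷ p) r i = begin
    coeff ((a ∷ p) *ₚ r) i                     ≈⟨ coeff-∷-* a p r i ⟩
    a * coeff r i + coeff (0# ∷ (p *ₚ r)) i    ≈⟨ +-congˡ (∷-cong {p = p *ₚ r} {r *ₚ p} refl (*ₚ-comm p r) i) ⟩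
    a * coeff r i + coeff (0# ∷ (r *ₚ p)) i    ≈⟨ *ₚ-∷ʳ r a p i ⟨
    coeff (r *ₚ (a ∷ p)) i                     ∎

  *ₚ-cong : ∀ p p′ r r′ → p ≈ₚ p′ → r ≈ₚ r′ → (p *ₚ r) ≈ₚ (p′ *ₚ r′)
  *ₚ-cong p p′ r r′ p≈p′ r≈r′ i = begin
    coeff (p *ₚ r) i      ≈⟨ *ₚ-congˡ p r r′ r≈r′ i ⟩
    coeff (p *ₚ r′) i     ≈⟨ *ₚ-comm p r′ i ⟩
    coeff (r′ *ₚ p) i     ≈⟨ *ₚ-congˡ r′ p p′ p≈p′ i ⟩
    coeff (r′ *ₚ p′) i    ≈⟨ *ₚ-comm r′ p′ i ⟩
    coeff (p′ *ₚ r′) i    ∎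

  *ₚ-distribˡ : ∀ p r s → (p *ₚ (r +ₚ s)) ≈ₚ ((p *ₚ r) +ₚ (p *ₚ s))
  *ₚ-distribˡ []      r s i = refl
  *ₚ-distribˡ (a ∷ p) r s i = begin
    coeff ((a ∷ p) *ₚ (r +ₚ s)) i                                  ≈⟨ coeff-∷-* a p (r +ₚ s) i ⟩
    a * coeff (r +ₚ s) i + coeff (0# ∷ (p *ₚ (r +ₚ s))) i          ≈⟨ +-cong (*-congˡ (coeff-+ r s i)) (shifted i) ⟩
    a * (coeff r i + coeff s i) + (coeff (0# ∷ (p *ₚ r)) i + coeff (0# ∷ (p *ₚ s)) i)
      ≈⟨ solve 5 (λ a x y z w → a :* (x :+ y) :+ (z :+ w) := (a :* x :+ z) :+ (a :* y :+ w)) refl a _ _ _ _ ⟩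
    (a * coeff r i + coeff (0# ∷ (p *ₚ r)) i) + (a * coeff s i + coeff (0# ∷ (p *ₚ s)) i)
      ≈⟨ +-cong (coeff-∷-* a p r i) (coeff-∷-* a p s i) ⟨
    coeff ((a ∷ p) *ₚ r) i + coeff ((a ∷ p) *ₚ s) i                ≈⟨ coeff-+ ((a ∷ p) *ₚ r) _ i ⟨
    coeff (((a ∷ p) *ₚ r) +ₚ ((a ∷ p) *ₚ s)) i                     ∎
    where
    shifted : ∀ i → coeff (0# ∷ (p *ₚ (r +ₚ s))) i
                    ≈ coeff (0# ∷ (p *ₚ r)) i + coeff (0# ∷ (p *ₚ s)) i
    shifted zero    = sym (+-identityˡ 0#)
    shifted (suc i) = trans (*ₚ-distribˡ p r s i) (coeff-+ (p *ₚ r) _ i)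

  *ₚ-distribʳ : ∀ p r s → ((r +ₚ s) *ₚ p) ≈ₚ ((r *ₚ p) +ₚ (s *ₚ p))
  *ₚ-distribʳ p r s i = begin
    coeff ((r +ₚ s) *ₚ p) i              ≈⟨ *ₚ-comm (r +ₚ s) p i ⟩
    coeff (p *ₚ (r +ₚ s)) i              ≈⟨ *ₚ-distribˡ p r s i ⟩
    coeff ((p *ₚ r) +ₚ (p *ₚ s)) i       ≈⟨ +ₚ-cong (p *ₚ r) (r *ₚ p) (p *ₚ s) (s *ₚ p) (*ₚ-comm p r) (*ₚ-comm p s) i ⟩
    coeff ((r *ₚ p) +ₚ (s *ₚ p)) i       ∎

  •-*-assoc : ∀ a p r i → coeff ((a •ₚ p) *ₚ r) i ≈ a * coeff (p *ₚ r) i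
  •-*-assoc a []      r i = sym (zeroʳ a)
  •-*-assoc a (b ∷ p) r i = begin
    coeff ((a * b ∷ (a •ₚ p)) *ₚ r) i                            ≈⟨ coeff-∷-* (a * b) (a •ₚ p) r i ⟩
    a * b * coeff r i + coeff (0# ∷ ((a •ₚ p) *ₚ r)) i           ≈⟨ +-congˡ (shifted i) ⟩
    a * b * coeff r i + a * coeff (0# ∷ (p *ₚ r)) i
      ≈⟨ solve 4 (λ a b x y → a :* b :* x :+ a :* y := a :* (b :* x :+ y)) refl a b _ _ ⟩
    a * (b * coeff r i + coeff (0# ∷ (p *ₚ r)) i)                ≈⟨ *-congˡ (coeff-∷-* b p r i) ⟨
    a * coeff ((b ∷ p) *ₚ r) i                                   ∎
    where
    shifted : ∀ i → coeff (0# ∷ ((a •ₚ p) *ₚ r)) i ≈ a * coeff (0# ∷ (p *ₚ r)) i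
    shifted zero    = sym (zeroʳ a)
    shifted (suc i) = •-*-assoc a p r i

  *ₚ-assoc : ∀ p r s → ((p *ₚ r) *ₚ s) ≈ₚ (p *ₚ (r *ₚ s))
  *ₚ-assoc []      r s i = refl
  *ₚ-assoc (a ∷ p) r s i = begin
    coeff (((a •ₚ r) +ₚ (0# ∷ (p *ₚ r))) *ₚ s) i                    ≈⟨ *ₚ-distribʳ s (a •ₚ r) _ i ⟩
    coeff (((a •ₚ r) *ₚ s) +ₚ ((0# ∷ (p *ₚ r)) *ₚ s)) i             ≈⟨ coeff-+ ((a •ₚ r) *ₚ s) _ i ⟩
    coeff ((a •ₚ r) *ₚ s) i + coeff ((0# ∷ (p *ₚ r)) *ₚ s) i        ≈⟨ +-cong (•-*-assoc a r s i) (shifted i) ⟩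
    a * coeff (r *ₚ s) i + coeff (0# ∷ (p *ₚ (r *ₚ s))) i           ≈⟨ coeff-∷-* a p (r *ₚ s) i ⟨
    coeff ((a ∷ p) *ₚ (r *ₚ s)) i                                   ∎
    where
    shifted : ∀ i → coeff ((0# ∷ (p *ₚ r)) *ₚ s) i ≈ coeff (0# ∷ (p *ₚ (r *ₚ s))) i
    shifted i = begin
      coeff ((0# ∷ (p *ₚ r)) *ₚ s) i                          ≈⟨ coeff-∷-* 0# (p *ₚ r) s i ⟩
      0# * coeff s i + coeff (0# ∷ ((p *ₚ r) *ₚ s)) i         ≈⟨ +-congʳ (zeroˡ _) ⟩
      0# + coeff (0# ∷ ((p *ₚ r) *ₚ s)) i                     ≈⟨ +-identityˡ _ ⟩
      coeff (0# ∷ ((p *ₚ r) *ₚ s)) i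
        ≈⟨ ∷-cong {p = (p *ₚ r) *ₚ s} {p *ₚ (r *ₚ s)} refl (*ₚ-assoc p r s) i ⟩
      coeff (0# ∷ (p *ₚ (r *ₚ s))) i                          ∎

  *ₚ-identityˡ : ∀ p → ((1# ∷ []) *ₚ p) ≈ₚ p
  *ₚ-identityˡ p i = begin
    coeff ((1# ∷ []) *ₚ p) i                ≈⟨ coeff-∷-* 1# [] p i ⟩
    1# * coeff p i + coeff (0# ∷ []) i      ≈⟨ +-cong (*-identityˡ _) (coeff-0#∷[] i) ⟩
    coeff p i + 0#                          ≈⟨ +-identityʳ _ ⟩
    coeff p i                               ∎
    where
    coeff-0#∷[] : ∀ i → coeff (0# ∷ []) i ≈ 0#
    coeff-0#∷[] zero    = refl
    coeff-0#∷[] (suc i) = refl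

  polynomialRing : CommutativeRing c ℓ
  polynomialRing = record
    { Carrier = Poly
    ; _≈_     = _≈ₚ_
    ; _+_     = _+ₚ_
    ; _*_     = _*ₚ_
    ; -_      = λ p → map -_ p
    ; 0#      = []
    ; 1#      = 1# ∷ []
    ; isCommutativeRing = record
      { isRing = record
        { +-isAbelianGroup = record
          { isGroup = record
            { isMonoid = record
              { isSemigroup = record
                { isMagma = record
                  { isEquivalence = record
                    { refl  = λ i → refl
                    ; sym   = λ p≈r i → sym (p≈r i)
                    ; trans = λ p≈r r≈s i → trans (p≈r i) (r≈s i)
                    }
                  ; ∙-cong = λ {p} {p′} {r} {r′} → +ₚ-cong p p′ r r′
                  }
                ; assoc = +ₚ-assoc
                }
              ; identity = (λ p i → refl) Σ., +ₚ-identityʳ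
              }
            ; inverse = (λ p i → trans (+ₚ-comm (map -_ p) p i) (+ₚ-inverseʳ p i)) Σ., +ₚ-inverseʳ
            ; ⁻¹-cong = λ {p} {r} → -ₚ-cong p r
            }
          ; comm = +ₚ-comm
          }
        ; *-cong     = λ {p} {p′} {r} {r′} → *ₚ-cong p p′ r r′
        ; *-assoc    = *ₚ-assoc
        ; *-identity = *ₚ-identityˡ Σ., (λ p i → trans (*ₚ-comm p (1# ∷ []) i) (*ₚ-identityˡ p i))
        ; distrib    = *ₚ-distribˡ Σ., *ₚ-distribʳ
        }
      ; *-comm = *ₚ-comm
      }
    }

-- Division by polynomials whose constant coefficient is its own inverse

module ConstantUnit {c ℓ} (R : CommutativeRing c ℓ) where

  open CommutativeRing R
  open IntegerCoefficientSolver R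
  open PolynomialRing R
  open SetoidReasoning setoid

  -- Compare constant coefficients. The condition that the constant coefficient of f squares to 1 is
  -- the ring-theoretic form of ±1, and it lets multiplication by that coefficient act as division.
  *ₚ-head : ∀ f a t p → coeff f 0 * coeff f 0 ≈ 1# → (f *ₚ (a ∷ t)) ≈ₚ p →
            a ≈ coeff p 0 * coeff f 0
  *ₚ-head f a t p unit ft≈p = begin
    a                                     ≈⟨ *-identityʳ a ⟨
    a * 1#                                ≈⟨ *-congˡ unit ⟨
    a * (f₀ * f₀)                         ≈⟨ solve 2 (λ a f → a :* (f :* f) := (f :* a) :* f) refl a f₀ ⟩
    (f₀ * a) * f₀                         ≈⟨ *-congʳ (coeff-*-zero f (a ∷ t)) ⟨
    coeff (f *ₚ (a ∷ t)) 0 * f₀           ≈⟨ *-congʳ (ft≈p 0) ⟩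
    coeff p 0 * f₀                        ∎
    where f₀ = coeff f 0

  -- One step of long division from the constant term upwards: removing a f from p and dividing by
  -- the indeterminate leaves the product of f with the rest of the quotient.
  *ₚ-tail : ∀ f a t p → (f *ₚ (a ∷ t)) ≈ₚ p →
            ∀ i → coeff (f *ₚ t) i ≈ coeff p (suc i) - a * coeff f (suc i)
  *ₚ-tail f a t p ft≈p i = begin
    coeff (f *ₚ t) i                                          ≈⟨ solve 2 (λ x y → x := (y :+ x) :- y) refl _ _ ⟩
    a * coeff f (suc i) + coeff (f *ₚ t) i - a * coeff f (suc i) ≈⟨ +-congʳ (*ₚ-∷ʳ f a t (suc i)) ⟨
    coeff (f *ₚ (a ∷ t)) (suc i) - a * coeff f (suc i)        ≈⟨ +-congʳ (ft≈p (suc i)) ⟩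
    coeff p (suc i) - a * coeff f (suc i)                     ∎

  -- Power series division: h = (n • G) / f has coefficients divisible by n because 1 / f exists.
  scalar-∣-cofactor : ∀ f n G h → coeff f 0 * coeff f 0 ≈ 1# →
                      (∀ i → coeff (f *ₚ h) i ≈ n * coeff G i) →
                      ∃ λ h′ → ∀ i → coeff h i ≈ n * coeff h′ i
  scalar-∣-cofactor f n G []      unit e = [] Σ., λ i → sym (zeroʳ n)
  scalar-∣-cofactor f n G (a ∷ t) unit e = (b ∷ proj₁ rest) Σ., λ
    { zero    → a≈nb
    ; (suc i) → proj₂ rest i }
    where
    e′ : (f *ₚ (a ∷ t)) ≈ₚ (n •ₚ G)
    e′ i = trans (e i) (sym (coeff-• n G i))

    b = coeff G 0 * coeff f 0

    a≈nb : a ≈ n * b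
    a≈nb = begin
      a                                ≈⟨ *ₚ-head f a t (n •ₚ G) unit e′ ⟩
      coeff (n •ₚ G) 0 * coeff f 0     ≈⟨ *-congʳ (coeff-• n G 0) ⟩
      n * coeff G 0 * coeff f 0        ≈⟨ *-assoc n _ _ ⟩
      n * b                            ∎

    -- The next partial dividend (G - b f) / q; with it the hypothesis holds again for the shorter
    -- cofactor t.
    G′ = drop 1 (G +ₚ (map -_ (b •ₚ f)))

    e″ : ∀ i → coeff (f *ₚ t) i ≈ n * coeff G′ i
    e″ i = begin
      coeff (f *ₚ t) i                                       ≈⟨ *ₚ-tail f a t (n •ₚ G) e′ i ⟩
      coeff (n •ₚ G) (suc i) - a * coeff f (suc i)           ≈⟨ +-cong (coeff-• n G (suc i)) (-‿cong (*-congʳ a≈nb)) ⟩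
      n * coeff G (suc i) - n * b * coeff f (suc i)
        ≈⟨ solve 4 (λ n g b f → n :* g :- n :* b :* f := n :* (g :- b :* f)) refl n _ b _ ⟩
      n * (coeff G (suc i) - b * coeff f (suc i))            ≈⟨ *-congˡ (+-congˡ (-‿cong (coeff-• b f (suc i)))) ⟨
      n * (coeff G (suc i) - coeff (b •ₚ f) (suc i))         ≈⟨ *-congˡ (+-congˡ (coeff-neg (b •ₚ f) (suc i))) ⟨
      n * (coeff G (suc i) + coeff (map -_ (b •ₚ f)) (suc i)) ≈⟨ *-congˡ (coeff-+ G _ (suc i)) ⟨
      n * coeff (G +ₚ map -_ (b •ₚ f)) (suc i)               ≈⟨ *-congˡ (coeff-drop (G +ₚ map -_ (b •ₚ f)) i) ⟨
      n * coeff G′ i                                         ∎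

    rest = scalar-∣-cofactor f n G′ t unit e″

ℤ[q]-ring : CommutativeRing 0ℓ 0ℓ
ℤ[q]-ring = PolynomialRing.polynomialRing ℤ.+-*-commutativeRing

-- Correctness of long division over ℤ

module Division where

  open PolynomialRing ℤ.+-*-commutativeRing
  open ConstantUnit ℤ.+-*-commutativeRing

  +ₚ-neg-• : ∀ a p r i → coeff (p +ₚ map ℤ.-_ (a •ₚ r)) i ≡ coeff p i ℤ.- a ℤ.* coeff r i
  +ₚ-neg-• a p r i = begin
    coeff (p +ₚ map ℤ.-_ (a •ₚ r)) i           ≡⟨ coeff-+ p _ i ⟩
    coeff p i ℤ.+ coeff (map ℤ.-_ (a •ₚ r)) i  ≡⟨ ≡.cong (λ z → coeff p i ℤ.+ z) (coeff-neg (a •ₚ r) i) ⟩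
    coeff p i ℤ.- coeff (a •ₚ r) i             ≡⟨ ≡.cong (λ z → coeff p i ℤ.- z) (coeff-• a r i) ⟩
    coeff p i ℤ.- a ℤ.* coeff r i              ∎
    where open ≡.≡-Reasoning

  -- The invariant is that h is an exact cofactor of the current dividend. A step reads off its
  -- constant coefficient and leaves `drop 1 h` as the exact cofactor of the next dividend.
  coeff-divide : ∀ fuel p f h → coeff f 0 ℤ.* coeff f 0 ≡ ℤ.1ℤ → (f *ₚ h) ≈ₚ p →
                 ∀ i → i ℕ.< fuel → coeff (divide fuel p f) i ≡ coeff h i
  coeff-divide (suc fuel) p f h unit fh≈p = λ
    { zero    _              → ≡.sym head≡
    ; (suc i) (ℕ.s≤s i<fuel) →
        ≡.trans (coeff-divide fuel _ f (drop 1 h) unit tail≈ i i<fuel) (coeff-drop h i) }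
    where
    a = coeff h 0

    h≈ : (a ∷ drop 1 h) ≈ₚ h
    h≈ zero    = ≡.refl
    h≈ (suc i) = coeff-drop h i

    f[ah]≈p : (f *ₚ (a ∷ drop 1 h)) ≈ₚ p
    f[ah]≈p i = ≡.trans (*ₚ-congˡ f _ h h≈ i) (fh≈p i)

    head≡ : a ≡ coeff p 0 ℤ.* coeff f 0
    head≡ = *ₚ-head f a (drop 1 h) p unit f[ah]≈p

    tail≈ : (f *ₚ drop 1 h) ≈ₚ drop 1 (p +ₚ map ℤ.-_ ((coeff p 0 ℤ.* coeff f 0) •ₚ f))
    tail≈ i = begin
      coeff (f *ₚ drop 1 h) i                               ≡⟨ *ₚ-tail f a (drop 1 h) p f[ah]≈p i ⟩
      coeff p (suc i) ℤ.- a ℤ.* coeff f (suc i)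
        ≡⟨ ≡.cong (λ z → coeff p (suc i) ℤ.- z ℤ.* coeff f (suc i)) head≡ ⟩
      coeff p (suc i) ℤ.- coeff p 0 ℤ.* coeff f 0 ℤ.* coeff f (suc i)
        ≡⟨ +ₚ-neg-• (coeff p 0 ℤ.* coeff f 0) p f (suc i) ⟨
      coeff (p +ₚ map ℤ.-_ ((coeff p 0 ℤ.* coeff f 0) •ₚ f)) (suc i)
        ≡⟨ coeff-drop (p +ₚ map ℤ.-_ ((coeff p 0 ℤ.* coeff f 0) •ₚ f)) i ⟨
      coeff (drop 1 (p +ₚ map ℤ.-_ ((coeff p 0 ℤ.* coeff f 0) •ₚ f))) i ∎
      where open ≡.≡-Reasoning

  coeff-divide-≥ : ∀ fuel p f i → fuel ℕ.≤ i → coeff (divide fuel p f) i ≡ ℤ.0ℤ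
  coeff-divide-≥ zero       p f i       _              = ≡.refl
  coeff-divide-≥ (suc fuel) p f (suc i) (ℕ.s≤s fuel≤i) = coeff-divide-≥ fuel _ f i fuel≤i

  coeff-≥-length : ∀ p i → length p ℕ.≤ i → coeff p i ≡ ℤ.0ℤ
  coeff-≥-length []      i       _            = ≡.refl
  coeff-≥-length (a ∷ p) (suc i) (ℕ.s≤s p≤i) = coeff-≥-length p i p≤i

  VanishesFrom : ℕ → Poly → Set
  VanishesFrom n p = ∀ i → n ℕ.≤ i → coeff p i ≡ ℤ.0ℤ

  -- Coefficient lists may end in zeros, so their length only bounds the degree. The witness e is
  -- the true degree.
  leading-or-zero : ∀ p → VanishesFrom 0 p ⊎ ∃ λ e → coeff p e ≢ ℤ.0ℤ × VanishesFrom (suc e) p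
  leading-or-zero [] = inj₁ (λ i _ → ≡.refl)
  leading-or-zero (a ∷ p) with leading-or-zero p
  ... | inj₂ (e Σ., pe≢0 Σ., p>e≡0) =
        inj₂ (suc e Σ., pe≢0 Σ., λ { (suc i) (ℕ.s≤s e<i) → p>e≡0 i e<i })
  ... | inj₁ p≡0 with a ℤ.≟ ℤ.0ℤ
  ...   | yes a≡0 = inj₁ λ { zero _ → a≡0 ; (suc i) _ → p≡0 i ℕ.z≤n }
  ...   | no  a≢0 = inj₂ (0 Σ., a≢0 Σ., λ { (suc i) _ → p≡0 i ℕ.z≤n })

  coeff-leading-* : ∀ f h e m → VanishesFrom (suc e) f → VanishesFrom (suc m) h →
                    coeff (f *ₚ h) (e ℕ.+ m) ≡ coeff f e ℤ.* coeff h m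
  coeff-leading-* []      h e       m f>e≡0 h>m≡0 = ≡.refl
  coeff-leading-* (a ∷ f) h zero    m f>e≡0 h>m≡0 =
    ≡.trans (coeff-∷-* a f h m) (≡.trans (≡.cong (λ z → a ℤ.* coeff h m ℤ.+ z) (shifted m)) (ℤ.+-identityʳ _))
    where
    f≈0 : f ≈ₚ []
    f≈0 i = f>e≡0 (suc i) (ℕ.s≤s ℕ.z≤n)

    shifted : ∀ i → coeff (ℤ.0ℤ ∷ (f *ₚ h)) i ≡ ℤ.0ℤ
    shifted zero    = ≡.refl
    shifted (suc i) = ≡.trans (*ₚ-comm f h i) (≡.trans (*ₚ-congˡ h f [] f≈0 i) (*ₚ-zeroʳ h i))
  coeff-leading-* (a ∷ f) h (suc e) m f>e≡0 h>m≡0 = begin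
    coeff ((a ∷ f) *ₚ h) (suc (e ℕ.+ m))                       ≡⟨ coeff-∷-* a f h (suc (e ℕ.+ m)) ⟩
    a ℤ.* coeff h (suc (e ℕ.+ m)) ℤ.+ coeff (f *ₚ h) (e ℕ.+ m)
      ≡⟨ ≡.cong₂ (λ y z → a ℤ.* y ℤ.+ z) (h>m≡0 _ (ℕ.s≤s (ℕ.m≤n+m m e))) ih ⟩
    a ℤ.* ℤ.0ℤ ℤ.+ coeff f e ℤ.* coeff h m                     ≡⟨ ≡.cong (ℤ._+ _) (ℤ.*-zeroʳ a) ⟩
    ℤ.0ℤ ℤ.+ coeff f e ℤ.* coeff h m                           ≡⟨ ℤ.+-identityˡ _ ⟩
    coeff f e ℤ.* coeff h m                                    ∎
    where
    open ≡.≡-Reasoning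
    ih = coeff-leading-* f h e m (λ i e<i → f>e≡0 (suc i) (ℕ.s≤s e<i)) h>m≡0

  -- Degrees add over ℤ: a topmost nonzero coefficient of h at or above n, times the leading
  -- coefficient of f, would be a nonzero coefficient of the product there. The known bound for h is
  -- lowered from n + `length h` to n one unit at a time.
  cofactor-vanishes : ∀ f h n → coeff f 0 ≢ ℤ.0ℤ → VanishesFrom n (f *ₚ h) → VanishesFrom n h
  cofactor-vanishes f h n f₀≢0 fh≡0 with leading-or-zero f
  ... | inj₁ f≡0 = contradiction (f≡0 0 ℕ.z≤n) f₀≢0
  ... | inj₂ (e Σ., fe≢0 Σ., f>e≡0) =
        descend (length h) (λ i n+l≤i → coeff-≥-length h i (ℕ.≤-trans (ℕ.m≤n+m _ n) n+l≤i))
    where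
    descend : ∀ k → VanishesFrom (n ℕ.+ k) h → VanishesFrom n h
    descend zero    h≡0 = ≡.subst (λ m → VanishesFrom m h) (ℕ.+-identityʳ n) h≡0
    descend (suc k) h≡0 = descend k λ i n+k≤i → case-≤ i (ℕ.m≤n⇒m<n∨m≡n n+k≤i)
      where
      h>m≡0 : VanishesFrom (suc (n ℕ.+ k)) h
      h>m≡0 = ≡.subst (λ m → VanishesFrom m h) (ℕ.+-suc n k) h≡0

      top≡0 : coeff h (n ℕ.+ k) ≡ ℤ.0ℤ
      top≡0 with ℤ.i*j≡0⇒i≡0∨j≡0 (coeff f e)
                   (≡.trans (≡.sym (coeff-leading-* f h e (n ℕ.+ k) f>e≡0 h>m≡0))
                            (fh≡0 _ (ℕ.≤-trans (ℕ.m≤m+n n k) (ℕ.m≤n+m _ e))))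
      ... | inj₁ fe≡0 = contradiction fe≡0 fe≢0
      ... | inj₂ h≡0  = h≡0

      case-≤ : ∀ i → n ℕ.+ k ℕ.< i ⊎ n ℕ.+ k ≡ i → coeff h i ≡ ℤ.0ℤ
      case-≤ i (inj₁ n+k<i)  = h>m≡0 i n+k<i
      case-≤ i (inj₂ ≡.refl) = top≡0

  -- Division stops after `length p` coefficients. Below this bound it reproduces h, and from there
  -- on h vanishes for degree reasons.
  ÷-correct : ∀ p f h → coeffq f 0 ℤ.* coeffq f 0 ≡ ℤ.1ℤ → (f *ₚ h) ≈ₚ p → (p ÷ f) ≈ₚ h
  ÷-correct p f h unit fh≈p i with i ℕ.<? length p
  ... | yes i<p = coeff-divide (length p) p f h unit fh≈p i i<p
  ... | no  i≮p = ≡.trans (coeff-divide-≥ (length p) p f i p≤i) (≡.sym h≡0)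
    where
    p≤i = ℕ.≮⇒≥ i≮p

    f₀≢0 : coeff f 0 ≢ ℤ.0ℤ
    f₀≢0 f₀≡0 with ≡.trans (≡.sym unit) (≡.cong (λ z → z ℤ.* z) f₀≡0)
    ... | ()

    h≡0 = cofactor-vanishes f h (length p) f₀≢0
            (λ j p≤j → ≡.trans (fh≈p j) (coeff-≥-length p j p≤j)) i p≤i

-- Gaussian binomials

module GaussianBinomial {c ℓ} (R : CommutativeRing c ℓ) (Q : CommutativeRing.Carrier R) where

  open CommutativeRing R
  open IntegerCoefficientSolver R
  open SemiringExp semiring using (_^_; ^-congʳ)
  open SetoidReasoning setoid

  -- The q-Pascal recursion makes sense in every commutative ring, in particular modulo Φ d, where
  -- the denominators of the product formula may become zero.
  binom : ℕ → ℕ → Carrier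
  binom _       zero    = 1#
  binom zero    (suc j) = 0#
  binom (suc k) (suc j) = binom k j + Q ^ suc j * binom k (suc j)

  binom-< : ∀ k j → k ℕ.< j → binom k j ≈ 0#
  binom-< zero    (suc j) _           = refl
  binom-< (suc k) (suc j) (ℕ.s≤s k<j) = begin
    binom k j + Q ^ suc j * binom k (suc j)
      ≈⟨ +-cong (binom-< k j k<j) (*-congˡ (binom-< k (suc j) (ℕ.m<n⇒m<1+n k<j))) ⟩
    0# + Q ^ suc j * 0#                        ≈⟨ trans (+-identityˡ _) (zeroʳ _) ⟩
    0#                                         ∎

  binom-diagonal : ∀ k → binom k k ≈ 1#
  binom-diagonal zero    = refl
  binom-diagonal (suc k) = begin
    binom k k + Q ^ suc k * binom k (suc k)    ≈⟨ +-cong (binom-diagonal k) (*-congˡ (binom-< k (suc k) ℕ.≤-refl)) ⟩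
    1# + Q ^ suc k * 0#                        ≈⟨ +-congˡ (zeroʳ _) ⟩
    1# + 0#                                    ≈⟨ +-identityʳ 1# ⟩
    1#                                         ∎

  -- The extra factor Q ^ j avoids the exponent k - j, which is negative for k < j.
  binom-sucʳ : ∀ k j → Q ^ j * (1# - Q ^ suc j) * binom k (suc j) ≈ (Q ^ j - Q ^ k) * binom k j
  -- A joint induction on k: absorption at k is the q-Pascal rule followed by `binom-sucʳ` at k, and
  -- `binom-sucʳ` at k + 1 rests on absorption at k.
  absorption : ∀ k j → (1# - Q ^ suc j) * binom (suc k) (suc j) ≈ (1# - Q ^ suc k) * binom k j

  binom-sucʳ zero    zero    =
    solve 1 (λ q → :1 :* (:1 :- q :* :1) :* con ℤ.0ℤ := (:1 :- :1) :* :1) refl Q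
  binom-sucʳ zero    (suc j) = trans (zeroʳ _) (sym (zeroʳ _))
  binom-sucʳ (suc k) zero    = begin
    1# * (1# - Q * 1#) * binom (suc k) 1    ≈⟨ *-congʳ (*-identityˡ _) ⟩
    (1# - Q * 1#) * binom (suc k) 1         ≈⟨ absorption k 0 ⟩
    (1# - Q ^ suc k) * 1#                   ∎
  binom-sucʳ (suc k) (suc j) = begin
    Q ^ suc j * (1# - Q ^ suc (suc j)) * binom (suc k) (suc (suc j))      ≈⟨ *-assoc _ _ _ ⟩
    Q ^ suc j * ((1# - Q ^ suc (suc j)) * binom (suc k) (suc (suc j)))    ≈⟨ *-congˡ (absorption k (suc j)) ⟩
    Q * Qʲ * ((1# - Q * Qᵏ) * b)
      ≈⟨ solve 4 (λ q x y b → q :* x :* ((:1 :- q :* y) :* b)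
                  := q :* (x :* (:1 :- q :* x) :* b) :+ (q :* x :- q :* y) :* (q :* x :* b)) refl Q Qʲ Qᵏ b ⟩
    Q * (Qʲ * (1# - Q * Qʲ) * b) + (Q * Qʲ - Q * Qᵏ) * (Q * Qʲ * b)       ≈⟨ +-congʳ (*-congˡ (binom-sucʳ k j)) ⟩
    Q * ((Qʲ - Qᵏ) * a) + (Q * Qʲ - Q * Qᵏ) * (Q * Qʲ * b)
      ≈⟨ solve 5 (λ q x y a b → q :* ((x :- y) :* a) :+ (q :* x :- q :* y) :* (q :* x :* b)
                  := (q :* x :- q :* y) :* (a :+ q :* x :* b)) refl Q Qʲ Qᵏ a b ⟩
    (Q * Qʲ - Q * Qᵏ) * (a + Q * Qʲ * b)                                  ∎
    where
    Qʲ = Q ^ j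
    Qᵏ = Q ^ k
    a = binom k j
    b = binom k (suc j)

  absorption k j = begin
    (1# - Q * Qʲ) * (a + Q * Qʲ * b)
      ≈⟨ solve 4 (λ q x a b → (:1 :- q :* x) :* (a :+ q :* x :* b)
                  := (:1 :- q :* x) :* a :+ q :* (x :* (:1 :- q :* x) :* b)) refl Q Qʲ a b ⟩
    (1# - Q * Qʲ) * a + Q * (Qʲ * (1# - Q * Qʲ) * b)    ≈⟨ +-congˡ (*-congˡ (binom-sucʳ k j)) ⟩
    (1# - Q * Qʲ) * a + Q * ((Qʲ - Qᵏ) * a)
      ≈⟨ solve 4 (λ q x y a → (:1 :- q :* x) :* a :+ q :* ((x :- y) :* a)
                  := (:1 :- q :* y) :* a) refl Q Qʲ Qᵏ a ⟩
    (1# - Q * Qᵏ) * a                                   ∎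
    where
    Qʲ = Q ^ j
    Qᵏ = Q ^ k
    a = binom k j
    b = binom k (suc j)

  ∏ : ℕ → (ℕ → Carrier) → Carrier
  ∏ = sumTo _*_ 1#

  ∏-suc : ∀ n f → ∏ (suc n) f ≈ ∏ n f * f n
  ∏-suc zero    f = *-comm _ _
  ∏-suc (suc n) f = trans (*-congˡ (∏-suc n (λ k → f (suc k)))) (sym (*-assoc _ _ _))

  -- Iterated absorption. The denominator stays on the left as it need not be invertible, and m + j
  -- avoids truncated subtraction.
  binom-product : ∀ m j → ∏ j (λ i → 1# - Q ^ suc i) * binom (m ℕ.+ j) j
                          ≈ ∏ j (λ i → 1# - Q ^ (m ℕ.+ suc i))
  binom-product m zero    = *-identityˡ 1#
  binom-product m (suc j) = begin
    ∏ (suc j) D * binom (m ℕ.+ suc j) (suc j)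
      ≈⟨ *-cong (∏-suc j D) (reflexive (≡.cong (λ n → binom n (suc j)) (ℕ.+-suc m j))) ⟩
    ∏ j D * (1# - Q ^ suc j) * binom (suc (m ℕ.+ j)) (suc j)      ≈⟨ *-assoc _ _ _ ⟩
    ∏ j D * ((1# - Q ^ suc j) * binom (suc (m ℕ.+ j)) (suc j))    ≈⟨ *-congˡ (absorption (m ℕ.+ j) j) ⟩
    ∏ j D * ((1# - Q ^ suc (m ℕ.+ j)) * binom (m ℕ.+ j) j)
      ≈⟨ solve 3 (λ x y z → x :* (y :* z) := x :* z :* y) refl _ _ _ ⟩
    ∏ j D * binom (m ℕ.+ j) j * (1# - Q ^ suc (m ℕ.+ j))
      ≈⟨ *-cong (binom-product m j) (+-congˡ (-‿cong (^-congʳ Q (≡.sym (ℕ.+-suc m j))))) ⟩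
    ∏ j N * (1# - Q ^ (m ℕ.+ suc j))                              ≈⟨ ∏-suc j N ⟨
    ∏ (suc j) N                                                   ∎
    where
    D N : ℕ → Carrier
    D i = 1# - Q ^ suc i
    N i = 1# - Q ^ (m ℕ.+ suc i)

-- Sums over roots of unity

module RootOfUnity {c ℓ} (A : CommutativeRing c ℓ) where

  open CommutativeRing A
  open IntegerCoefficientSolver A
  open FiniteSums A
  open SemiringExp semiring using (_^_; ^-congˡ; ^-congʳ; ^-homo-*; ^-assocʳ)
  open SetoidReasoning setoid

  -- `regular` stands in for primitivity of ζ: the ring is not assumed to be a domain, so a division
  -- by 1 - ζ ^ i becomes a multiplication followed by a cancellation.
  module _ (ζ : Carrier) (d′ : ℕ) (1<d : 1 ℕ.< suc d′) (ζ^d≈1 : ζ ^ suc d′ ≈ 1#)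
    (regular : ∀ i → 0 ℕ.< i → i ℕ.< suc d′ → ∀ a → (1# - ζ ^ i) * a ≈ 0# → a ≈ 0#)
    where

    open GaussianBinomial A ζ

    private
      d = suc d′

    1^n≈1 : ∀ n → 1# ^ n ≈ 1#
    1^n≈1 zero    = refl
    1^n≈1 (suc n) = trans (*-identityˡ _) (1^n≈1 n)

    ^-swap : ∀ k e → (ζ ^ k) ^ e ≈ (ζ ^ e) ^ k
    ^-swap k e = begin
      (ζ ^ k) ^ e      ≈⟨ ^-assocʳ ζ k e ⟩
      ζ ^ (k ℕ.* e)    ≈⟨ ^-congʳ ζ (ℕ.*-comm k e) ⟩
      ζ ^ (e ℕ.* k)    ≈⟨ ^-assocʳ ζ e k ⟨
      (ζ ^ e) ^ k      ∎

    ζ^[e]^d≈1 : ∀ e → (ζ ^ e) ^ d ≈ 1#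
    ζ^[e]^d≈1 e = begin
      (ζ ^ e) ^ d    ≈⟨ ^-swap d e ⟨
      (ζ ^ d) ^ e    ≈⟨ ^-congˡ e ζ^d≈1 ⟩
      1# ^ e         ≈⟨ 1^n≈1 e ⟩
      1#             ∎

    ζ^-periodic : ∀ m k → ζ ^ (m ℕ.* d ℕ.+ k) ≈ ζ ^ k
    ζ^-periodic m k = begin
      ζ ^ (m ℕ.* d ℕ.+ k)     ≈⟨ ^-homo-* ζ (m ℕ.* d) k ⟩
      ζ ^ (m ℕ.* d) * ζ ^ k   ≈⟨ *-congʳ (trans (sym (^-assocʳ ζ m d)) (ζ^[e]^d≈1 m)) ⟩
      1# * ζ ^ k              ≈⟨ *-identityˡ _ ⟩
      ζ ^ k                   ∎

    ζ^d+k≈ζ^k : ∀ k → ζ ^ (d ℕ.+ k) ≈ ζ ^ k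
    ζ^d+k≈ζ^k k = trans (^-congʳ ζ (≡.cong (ℕ._+ k) (≡.sym (ℕ.*-identityˡ d)))) (ζ^-periodic 1 k)

    ζ-regular : ∀ a → ζ * a ≈ 0# → a ≈ 0#
    ζ-regular a ζa≈0 = begin
      a                   ≈⟨ *-identityˡ a ⟨
      1# * a              ≈⟨ *-congʳ ζ^d≈1 ⟨
      ζ * ζ ^ d′ * a      ≈⟨ solve 3 (λ z w a → z :* w :* a := w :* (z :* a)) refl ζ (ζ ^ d′) a ⟩
      ζ ^ d′ * (ζ * a)    ≈⟨ *-congˡ ζa≈0 ⟩
      ζ ^ d′ * 0#         ≈⟨ zeroʳ _ ⟩
      0#                  ∎

    ζ^-regular : ∀ i a → ζ ^ i * a ≈ 0# → a ≈ 0#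
    ζ^-regular zero    a e = trans (sym (*-identityˡ a)) e
    ζ^-regular (suc i) a e = ζ^-regular i a (ζ-regular _ (trans (sym (*-assoc _ _ _)) e))

    -- A polynomial kept as its list of roots, so that it can be expanded one linear factor at a
    -- time. The sign r - z matches the factor Q ^ j - Q ^ k in `binom-sucʳ`.
    evalRoots : List Carrier → Carrier → Carrier
    evalRoots rs z = foldr (λ r p → (r - z) * p) 1# rs

    evalRoots-++ : ∀ rs ss z → evalRoots (rs ++ ss) z ≈ evalRoots rs z * evalRoots ss z
    evalRoots-++ []       ss z = sym (*-identityˡ _)
    evalRoots-++ (r ∷ rs) ss z = trans (*-congˡ (evalRoots-++ rs ss z)) (sym (*-assoc _ _ _))

    powerSum : ℕ → List Carrier → Carrier
    powerSum e rs = ∑ d (λ k → (ζ ^ k) ^ e * evalRoots rs (ζ ^ k))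

    powerSum-∷ : ∀ e r rs → powerSum e (r ∷ rs) ≈ r * powerSum e rs - powerSum (suc e) rs
    powerSum-∷ e r rs = begin
      ∑ d (λ k → z k ^ e * ((r - z k) * P k))
        ≈⟨ ∑-cong d (λ k _ → solve 4 (λ w r z p → w :* ((r :- z) :* p) := r :* (w :* p) :+ :- :1 :* (z :* w :* p)) refl (z k ^ e) r (z k) (P k)) ⟩
      ∑ d (λ k → r * (z k ^ e * P k) + - 1# * (z k ^ suc e * P k))
        ≈⟨ ∑-distrib-+ d (λ k → r * F k) (λ k → - 1# * G k) ⟩
      ∑ d (λ k → r * (z k ^ e * P k)) + ∑ d (λ k → - 1# * (z k ^ suc e * P k))
        ≈⟨ +-cong (*-distribˡ-∑ d r F) (*-distribˡ-∑ d (- 1#) G) ⟨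
      r * powerSum e rs + - 1# * powerSum (suc e) rs
        ≈⟨ solve 2 (λ x y → x :+ :- :1 :* y := x :- y) refl _ _ ⟩
      r * powerSum e rs - powerSum (suc e) rs                             ∎
      where
      z P F G : ℕ → Carrier
      z k = ζ ^ k
      P k = evalRoots rs (ζ ^ k)
      F k = z k ^ e * P k
      G k = z k ^ suc e * P k

    powerSum-[]≈0 : ∀ e → 0 ℕ.< e → e ℕ.< d → powerSum e [] ≈ 0#
    powerSum-[]≈0 e 0<e e<d = regular e 0<e e<d _ (begin
      (1# - ζ ^ e) * powerSum e []              ≈⟨ *-congˡ (∑-cong d (λ k _ → trans (*-identityʳ _) (^-swap k e))) ⟩
      (1# - ζ ^ e) * ∑ d (λ k → (ζ ^ e) ^ k)    ≈⟨ geometric-sum d (ζ ^ e) ⟩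
      1# - (ζ ^ e) ^ d                          ≈⟨ +-congˡ (-‿cong (ζ^[e]^d≈1 e)) ⟩
      1# - 1#                                   ≈⟨ -‿inverseʳ 1# ⟩
      0#                                        ∎)

    -- Each expanded factor replaces a root by at most one more power of z. All exponents that arise
    -- lie between e and e + `length rs`, strictly between 0 and d, where the geometric series
    -- vanishes.
    powerSum≈0 : ∀ e rs → 0 ℕ.< e → e ℕ.+ length rs ℕ.< d → powerSum e rs ≈ 0#
    powerSum≈0 e []       0<e e+l<d =
      powerSum-[]≈0 e 0<e (≡.subst (ℕ._< d) (ℕ.+-identityʳ e) e+l<d)
    powerSum≈0 e (r ∷ rs) 0<e e+l<d = begin
      powerSum e (r ∷ rs)                       ≈⟨ powerSum-∷ e r rs ⟩
      r * powerSum e rs - powerSum (suc e) rs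
        ≈⟨ +-cong (*-congˡ (powerSum≈0 e rs 0<e e+l<d′)) (-‿cong (powerSum≈0 (suc e) rs ℕ.z<s 1+e+l<d)) ⟩
      r * 0# - 0#                               ≈⟨ solve 1 (λ r → r :* con ℤ.0ℤ :- con ℤ.0ℤ := con ℤ.0ℤ) refl r ⟩
      0#                                        ∎
      where
      1+e+l<d : suc e ℕ.+ length rs ℕ.< d
      1+e+l<d = ≡.subst (ℕ._< d) (ℕ.+-suc e (length rs)) e+l<d
      e+l<d′ : e ℕ.+ length rs ℕ.< d
      e+l<d′ = ℕ.<-trans (ℕ.n<1+n _) 1+e+l<d

    -- (-1) ^ length rs times the sum of z ^ d = 1 over the d-th roots of unity z
    topSum : List Carrier → Carrier
    topSum []       = powerSum d []
    topSum (r ∷ rs) = - topSum rs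

    powerSum≈topSum : ∀ e rs → 0 ℕ.< e → e ℕ.+ length rs ≡ d → powerSum e rs ≈ topSum rs
    powerSum≈topSum e []       0<e e+l≡d =
      reflexive (≡.cong (λ e → powerSum e []) (≡.trans (≡.sym (ℕ.+-identityʳ e)) e+l≡d))
    powerSum≈topSum e (r ∷ rs) 0<e e+l≡d = begin
      powerSum e (r ∷ rs)                       ≈⟨ powerSum-∷ e r rs ⟩
      r * powerSum e rs - powerSum (suc e) rs
        ≈⟨ +-cong (*-congˡ (powerSum≈0 e rs 0<e e+l<d)) (-‿cong (powerSum≈topSum (suc e) rs ℕ.z<s 1+e+l≡d)) ⟩
      r * 0# - topSum rs                        ≈⟨ solve 2 (λ r t → r :* con ℤ.0ℤ :- t := :- t) refl r _ ⟩
      - topSum rs                               ∎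
      where
      1+e+l≡d : suc e ℕ.+ length rs ≡ d
      1+e+l≡d = ≡.trans (≡.sym (ℕ.+-suc e (length rs))) e+l≡d
      e+l<d : e ℕ.+ length rs ℕ.< d
      e+l<d = ℕ.≤-reflexive 1+e+l≡d

    total : List Carrier → Carrier
    total = foldr _+_ 0#

    -- Only the exponents d + 1 and d matter. The former contributes the sum of all z, which is zero
    -- as 1 < d; the coefficient of the latter is, by Vieta, the sum of the roots up to sign.
    powerSum-overflow : ∀ e rs → 0 ℕ.< e → e ℕ.+ length rs ≡ suc d →
                        powerSum e rs ≈ - (total rs * topSum rs)
    powerSum-overflow e [] 0<e e+l≡1+d = begin
      powerSum e []                      ≡⟨ ≡.cong (λ e → powerSum e []) (≡.trans (≡.sym (ℕ.+-identityʳ e)) e+l≡1+d) ⟩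
      powerSum (suc d) []                ≈⟨ ∑-cong d (λ k _ → *-congʳ {1#} (*-congˡ {ζ ^ k} (ζ^[e]^d≈1 k))) ⟩
      powerSum 1 []                      ≈⟨ powerSum-[]≈0 1 ℕ.z<s 1<d ⟩
      0#                                 ≈⟨ solve 1 (λ t → con ℤ.0ℤ := :- (con ℤ.0ℤ :* t)) refl _ ⟩
      - (0# * topSum [])                 ∎
    powerSum-overflow e (r ∷ rs) 0<e e+l≡1+d = begin
      powerSum e (r ∷ rs)                       ≈⟨ powerSum-∷ e r rs ⟩
      r * powerSum e rs - powerSum (suc e) rs
        ≈⟨ +-cong (*-congˡ (powerSum≈topSum e rs 0<e (ℕ.suc-injective 1+e+l≡1+d))) (-‿cong (powerSum-overflow (suc e) rs ℕ.z<s 1+e+l≡1+d)) ⟩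
      r * topSum rs - - (total rs * topSum rs)
        ≈⟨ solve 3 (λ r s t → r :* t :- :- (s :* t) := :- ((r :+ s) :* :- t)) refl r _ _ ⟩
      - ((r + total rs) * - topSum rs)          ∎
      where
      1+e+l≡1+d : suc e ℕ.+ length rs ≡ suc d
      1+e+l≡1+d = ≡.trans (≡.sym (ℕ.+-suc e (length rs))) e+l≡1+d

    roots : ℕ → List Carrier
    roots zero    = []
    roots (suc j) = ζ ^ j ∷ roots j

    length-roots : ∀ j → length (roots j) ≡ j
    length-roots zero    = ≡.refl
    length-roots (suc j) = ≡.cong suc (length-roots j)

    total-roots : ∀ j → (1# - ζ) * total (roots j) ≈ 1# - ζ ^ j
    total-roots zero    = trans (zeroʳ _) (sym (-‿inverseʳ 1#))
    total-roots (suc j) = begin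
      (1# - ζ) * (ζ ^ j + total (roots j))
        ≈⟨ solve 3 (λ z w s → (:1 :- z) :* (w :+ s) := w :- z :* w :+ (:1 :- z) :* s) refl ζ (ζ ^ j) _ ⟩
      ζ ^ j - ζ * ζ ^ j + (1# - ζ) * total (roots j)    ≈⟨ +-congˡ (total-roots j) ⟩
      ζ ^ j - ζ * ζ ^ j + (1# - ζ ^ j)
        ≈⟨ solve 2 (λ z w → w :- z :* w :+ (:1 :- w) := :1 :- z :* w) refl ζ (ζ ^ j) ⟩
      1# - ζ ^ suc j                                    ∎

    total-++ : ∀ rs ss → total (rs ++ ss) ≈ total rs + total ss
    total-++ []       ss = sym (+-identityˡ _)
    total-++ (r ∷ rs) ss = trans (+-congˡ (total-++ rs ss)) (sym (+-assoc _ _ _))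

    -- Collects the left-hand factors of `binom-sucʳ`. For j < d it is cancellable: ζ is a unit and
    -- the exponents in the factors 1 - ζ ^ i stay below d.
    scale : ℕ → Carrier
    scale zero    = 1#
    scale (suc j) = scale j * (ζ ^ j * (1# - ζ ^ suc j))

    scale-regular : ∀ j → j ℕ.< d → ∀ a → scale j * a ≈ 0# → a ≈ 0#
    scale-regular zero    _   a e = trans (sym (*-identityˡ a)) e
    scale-regular (suc j) j<d a e =
      regular (suc j) ℕ.z<s j<d a (ζ^-regular j _ (trans (sym (*-assoc _ _ _))
        (scale-regular j (ℕ.<-trans (ℕ.n<1+n j) j<d) _ (trans (sym (*-assoc _ _ _)) e))))

    scale-binom : ∀ k j → scale j * binom k j ≈ evalRoots (roots j) (ζ ^ k)
    scale-binom k zero    = *-identityˡ 1#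
    scale-binom k (suc j) = begin
      scale j * (ζ ^ j * (1# - ζ ^ suc j)) * binom k (suc j)      ≈⟨ *-assoc _ _ _ ⟩
      scale j * (ζ ^ j * (1# - ζ ^ suc j) * binom k (suc j))      ≈⟨ *-congˡ (binom-sucʳ k j) ⟩
      scale j * ((ζ ^ j - ζ ^ k) * binom k j)
        ≈⟨ solve 3 (λ x y z → x :* (y :* z) := y :* (x :* z)) refl _ _ _ ⟩
      (ζ ^ j - ζ ^ k) * (scale j * binom k j)                     ≈⟨ *-congˡ (scale-binom k j) ⟩
      (ζ ^ j - ζ ^ k) * evalRoots (roots j) (ζ ^ k)               ∎

    moment : ℕ → ℕ → ℕ → Carrier
    moment e n j = ∑ n (λ k → (ζ ^ k) ^ e * (binom k j * binom k j))

    scale²-moment : ∀ e j → scale j * scale j * moment e d j ≈ powerSum e (roots j ++ roots j)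
    scale²-moment e j = trans (*-distribˡ-∑ d (s * s) (λ k → (ζ ^ k) ^ e * (binom k j * binom k j))) (∑-cong d λ k _ → begin
      s * s * ((ζ ^ k) ^ e * (binom k j * binom k j))
        ≈⟨ solve 3 (λ s w b → s :* s :* (w :* (b :* b)) := w :* ((s :* b) :* (s :* b))) refl s _ _ ⟩
      (ζ ^ k) ^ e * ((s * binom k j) * (s * binom k j))   ≈⟨ *-congˡ (*-cong (scale-binom k j) (scale-binom k j)) ⟩
      (ζ ^ k) ^ e * (evalRoots (roots j) (ζ ^ k) * evalRoots (roots j) (ζ ^ k))
        ≈⟨ *-congˡ (evalRoots-++ (roots j) (roots j) (ζ ^ k)) ⟨
      (ζ ^ k) ^ e * evalRoots (roots j ++ roots j) (ζ ^ k) ∎)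
      where
      s = scale j

    scale²-regular : ∀ j → j ℕ.< d → ∀ a → scale j * scale j * a ≈ 0# → a ≈ 0#
    scale²-regular j j<d a e =
      scale-regular j j<d a (scale-regular j j<d _ (trans (sym (*-assoc _ _ _)) e))

    length-roots² : ∀ j → length (roots j ++ roots j) ≡ j ℕ.+ j
    length-roots² j = ≡.trans (List.length-++ (roots j)) (≡.cong₂ ℕ._+_ (length-roots j) (length-roots j))

    moment≈0 : ∀ e j → 0 ℕ.< e → e ℕ.+ (j ℕ.+ j) ℕ.< d → moment e d j ≈ 0#
    moment≈0 e j 0<e e+2j<d = scale²-regular j j<d _
      (trans (scale²-moment e j)
        (powerSum≈0 e (roots j ++ roots j) 0<e (≡.subst (λ l → e ℕ.+ l ℕ.< d) (≡.sym (length-roots² j)) e+2j<d)))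
      where
      j<d : j ℕ.< d
      j<d = ℕ.≤-<-trans (ℕ.≤-trans (ℕ.m≤m+n j j) (ℕ.m≤n+m _ e)) e+2j<d

    -- Up to the square of `scale j`, M₁ is the top sum t and M₂ is -2 S t, where S is the sum of ζ
    -- ^ i over i < j. Eliminating t and using (1 - ζ) S = 1 - ζ ^ j gives the relation.
    moment-relation : ∀ j → suc (j ℕ.+ j) ≡ d →
      (1# - ζ) * moment 2 d j + ((1# - ζ ^ j) * moment 1 d j + (1# - ζ ^ j) * moment 1 d j) ≈ 0#
    moment-relation j 1+2j≡d = scale²-regular j (ℕ.≤-<-trans (ℕ.m≤m+n j j) (ℕ.≤-reflexive 1+2j≡d)) _ (begin
      s * s * ((1# - ζ) * M₂ + ((1# - ζ ^ j) * M₁ + (1# - ζ ^ j) * M₁))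
        ≈⟨ solve 5 (λ s z w x y → s :* s :* ((:1 :- z) :* y :+ ((:1 :- w) :* x :+ (:1 :- w) :* x))
                    := (:1 :- z) :* (s :* s :* y) :+ ((:1 :- w) :* (s :* s :* x) :+ (:1 :- w) :* (s :* s :* x)))
                 refl s ζ (ζ ^ j) M₁ M₂ ⟩
      (1# - ζ) * (s * s * M₂) + ((1# - ζ ^ j) * (s * s * M₁) + (1# - ζ ^ j) * (s * s * M₁))
        ≈⟨ +-cong (*-congˡ sM₂) (+-cong (*-congˡ sM₁) (*-congˡ sM₁)) ⟩
      (1# - ζ) * - ((S + S) * t) + ((1# - ζ ^ j) * t + (1# - ζ ^ j) * t)
        ≈⟨ solve 4 (λ z w s t → (:1 :- z) :* :- ((s :+ s) :* t) :+ ((:1 :- w) :* t :+ (:1 :- w) :* t)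
                    := (:1 :- w :- (:1 :- z) :* s) :* (t :+ t)) refl ζ (ζ ^ j) S t ⟩
      (1# - ζ ^ j - (1# - ζ) * S) * (t + t)    ≈⟨ *-congʳ (trans (+-congˡ (-‿cong (total-roots j))) (-‿inverseʳ _)) ⟩
      0# * (t + t)                             ≈⟨ zeroˡ _ ⟩
      0#                                       ∎)
      where
      s = scale j
      M₁ = moment 1 d j
      M₂ = moment 2 d j
      S = total (roots j)
      t = topSum (roots j ++ roots j)
      sM₁ : s * s * M₁ ≈ t
      sM₁ = trans (scale²-moment 1 j)
        (powerSum≈topSum 1 (roots j ++ roots j) ℕ.z<s (≡.trans (≡.cong suc (length-roots² j)) 1+2j≡d))
      sM₂ : s * s * M₂ ≈ - ((S + S) * t)
      sM₂ = trans (scale²-moment 2 j) (trans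
        (powerSum-overflow 2 (roots j ++ roots j) ℕ.z<s (≡.cong suc (≡.trans (≡.cong suc (length-roots² j)) 1+2j≡d)))
        (-‿cong (*-congʳ (total-++ (roots j) (roots j)))))

    -- The q-Lucas theorem

    binom-periodic-< : ∀ k j → j ℕ.< d → binom (d ℕ.+ k) j ≈ binom k j
    binom-periodic-< k       zero    j<d = refl
    binom-periodic-< zero    (suc j) j<d = begin
      binom (d ℕ.+ 0) (suc j)    ≡⟨ ≡.cong (λ n → binom n (suc j)) (ℕ.+-identityʳ d) ⟩
      -- Absorption extracts the factor 1 - ζ ^ d = 0, so the inner entries of row d vanish; the
      -- q-Pascal rule carries this on to all later rows.
      binom d (suc j)            ≈⟨ regular (suc j) ℕ.z<s j<d _ (begin
        (1# - ζ ^ suc j) * binom d (suc j)     ≈⟨ absorption d′ j ⟩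
        (1# - ζ ^ d) * binom d′ j              ≈⟨ *-congʳ (trans (+-congˡ (-‿cong ζ^d≈1)) (-‿inverseʳ 1#)) ⟩
        0# * binom d′ j                        ≈⟨ zeroˡ _ ⟩
        0#                                     ∎) ⟩
      0#                         ∎
    binom-periodic-< (suc k) (suc j) j<d = begin
      binom (d ℕ.+ suc k) (suc j)                                  ≡⟨ ≡.cong (λ n → binom n (suc j)) (ℕ.+-suc d k) ⟩
      binom (d ℕ.+ k) j + ζ ^ suc j * binom (d ℕ.+ k) (suc j)
        ≈⟨ +-cong (binom-periodic-< k j (ℕ.<-trans (ℕ.n<1+n j) j<d)) (*-congˡ (binom-periodic-< k (suc j) j<d)) ⟩
      binom k j + ζ ^ suc j * binom k (suc j)                      ∎

    -- This is the q-Vandermonde convolution of the rows d and k, in which only the extreme entries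
    -- of row d survive, both equal to 1. The q-Pascal rule reaches it without the full convolution.
    binom-periodic-≥ : ∀ k j → binom (d ℕ.+ k) (d ℕ.+ j) ≈ binom k (d ℕ.+ j) + binom k j
    binom-periodic-≥ zero zero = begin
      binom (d ℕ.+ 0) (d ℕ.+ 0)    ≈⟨ binom-diagonal (d ℕ.+ 0) ⟩
      1#                           ≈⟨ +-identityˡ 1# ⟨
      0# + 1#                      ∎
    binom-periodic-≥ zero (suc j) = begin
      binom (d ℕ.+ 0) (d ℕ.+ suc j)    ≈⟨ binom-< (d ℕ.+ 0) (d ℕ.+ suc j) (ℕ.+-monoʳ-< d ℕ.z<s) ⟩
      0#                               ≈⟨ +-identityˡ 0# ⟨
      0# + 0#                          ∎
    binom-periodic-≥ (suc k) zero = begin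
      binom (d ℕ.+ suc k) (d ℕ.+ 0)
        ≡⟨ ≡.cong (λ n → binom n (d ℕ.+ 0)) (ℕ.+-suc d k) ⟩
      binom (d ℕ.+ k) (d′ ℕ.+ 0) + ζ ^ (d ℕ.+ 0) * binom (d ℕ.+ k) (d ℕ.+ 0)
        ≈⟨ +-cong (binom-periodic-< k (d′ ℕ.+ 0) (ℕ.≤-reflexive (≡.cong suc (ℕ.+-identityʳ d′)))) (*-congˡ (binom-periodic-≥ k 0)) ⟩
      binom k (d′ ℕ.+ 0) + ζ ^ (d ℕ.+ 0) * (binom k (d ℕ.+ 0) + 1#)
        ≈⟨ solve 3 (λ a z b → a :+ z :* (b :+ :1) := a :+ z :* b :+ z) refl _ _ _ ⟩
      binom (suc k) (d ℕ.+ 0) + ζ ^ (d ℕ.+ 0)                                ≈⟨ +-congˡ (ζ^d+k≈ζ^k 0) ⟩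
      binom (suc k) (d ℕ.+ 0) + 1#                                           ∎
    binom-periodic-≥ (suc k) (suc j) = begin
      binom (d ℕ.+ suc k) (d ℕ.+ suc j)
        ≡⟨ ≡.cong (λ n → binom n (d ℕ.+ suc j)) (ℕ.+-suc d k) ⟩
      binom (d ℕ.+ k) (d′ ℕ.+ suc j) + z * binom (d ℕ.+ k) (d ℕ.+ suc j)
        ≈⟨ +-cong lower (*-congˡ (binom-periodic-≥ k (suc j))) ⟩
      (binom k (d′ ℕ.+ suc j) + binom k j) + z * (binom k (d ℕ.+ suc j) + binom k (suc j))
        ≈⟨ solve 5 (λ x y z u v → (x :+ y) :+ z :* (u :+ v) := (x :+ z :* u) :+ (y :+ z :* v)) refl _ _ _ _ _ ⟩
      binom (suc k) (d ℕ.+ suc j) + (binom k j + z * binom k (suc j))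
        ≈⟨ +-congˡ (+-congˡ (*-congʳ (ζ^d+k≈ζ^k (suc j)))) ⟩
      binom (suc k) (d ℕ.+ suc j) + binom (suc k) (suc j)                    ∎
      where
      z = ζ ^ (d ℕ.+ suc j)
      lower : binom (d ℕ.+ k) (d′ ℕ.+ suc j) ≈ binom k (d′ ℕ.+ suc j) + binom k j
      lower = begin
        binom (d ℕ.+ k) (d′ ℕ.+ suc j)         ≡⟨ ≡.cong (binom (d ℕ.+ k)) (ℕ.+-suc d′ j) ⟩
        binom (d ℕ.+ k) (d ℕ.+ j)              ≈⟨ binom-periodic-≥ k j ⟩
        binom k (d ℕ.+ j) + binom k j          ≡⟨ ≡.cong (λ n → binom k n + binom k j) (ℕ.+-suc d′ j) ⟨
        binom k (d′ ℕ.+ suc j) + binom k j     ∎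

    -- Ordinary binomial coefficients as ring elements; q-Lucas attaches them to the quotients by d.
    pascal : ℕ → ℕ → Carrier
    pascal _       zero    = 1#
    pascal zero    (suc j) = 0#
    pascal (suc k) (suc j) = pascal k (suc j) + pascal k j

    -- Removing one period d from the upper index turns `binom-periodic-≥` into Pascal's rule for
    -- the quotients.
    lucas : ∀ k k₀ j j₀ → k₀ ℕ.< d → j₀ ℕ.< d →
            binom (k ℕ.* d ℕ.+ k₀) (j ℕ.* d ℕ.+ j₀) ≈ pascal k j * binom k₀ j₀
    lucas zero    k₀ zero    j₀ k₀<d j₀<d = sym (*-identityˡ _)
    lucas zero    k₀ (suc j) j₀ k₀<d j₀<d =
      trans (binom-< k₀ _ (ℕ.<-≤-trans k₀<d (ℕ.≤-trans (ℕ.m≤m+n d (j ℕ.* d)) (ℕ.m≤m+n _ j₀))))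
            (sym (zeroˡ _))
    lucas (suc k) k₀ zero    j₀ k₀<d j₀<d = begin
      binom (d ℕ.+ k ℕ.* d ℕ.+ k₀) j₀      ≡⟨ ≡.cong (λ n → binom n j₀) (ℕ.+-assoc d (k ℕ.* d) k₀) ⟩
      binom (d ℕ.+ (k ℕ.* d ℕ.+ k₀)) j₀    ≈⟨ binom-periodic-< _ j₀ j₀<d ⟩
      binom (k ℕ.* d ℕ.+ k₀) j₀            ≈⟨ lucas k k₀ 0 j₀ k₀<d j₀<d ⟩
      pascal k 0 * binom k₀ j₀             ∎
    lucas (suc k) k₀ (suc j) j₀ k₀<d j₀<d = begin
      binom (d ℕ.+ k ℕ.* d ℕ.+ k₀) (d ℕ.+ j ℕ.* d ℕ.+ j₀)
        ≡⟨ ≡.cong₂ binom (ℕ.+-assoc d (k ℕ.* d) k₀) (ℕ.+-assoc d (j ℕ.* d) j₀) ⟩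
      binom (d ℕ.+ K) (d ℕ.+ (j ℕ.* d ℕ.+ j₀))               ≈⟨ binom-periodic-≥ K _ ⟩
      binom K (d ℕ.+ (j ℕ.* d ℕ.+ j₀)) + binom K (j ℕ.* d ℕ.+ j₀)
        ≡⟨ ≡.cong (λ n → binom K n + binom K (j ℕ.* d ℕ.+ j₀)) (ℕ.+-assoc d (j ℕ.* d) j₀) ⟨
      binom K (suc j ℕ.* d ℕ.+ j₀) + binom K (j ℕ.* d ℕ.+ j₀)
        ≈⟨ +-cong (lucas k k₀ (suc j) j₀ k₀<d j₀<d) (lucas k k₀ j j₀ k₀<d j₀<d) ⟩
      pascal k (suc j) * binom k₀ j₀ + pascal k j * binom k₀ j₀
        ≈⟨ distribʳ _ _ _ ⟨
      (pascal k (suc j) + pascal k j) * binom k₀ j₀          ∎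
      where K = k ℕ.* d ℕ.+ k₀

    -- By q-Lucas each period contributes the same moment times the square of a binomial
    -- coefficient. C comes before e: a relation between M₁ and M₂ survives only if both are scaled
    -- alike.
    moment-periods : ∀ m j j₀ → j₀ ℕ.< d →
                     ∃ λ C → ∀ e → moment e (m ℕ.* d) (j ℕ.* d ℕ.+ j₀) ≈ C * moment e d j₀
    moment-periods zero    j j₀ j₀<d = 0# Σ., λ e → sym (zeroˡ _)
    moment-periods (suc m) j j₀ j₀<d with moment-periods m j j₀ j₀<d
    ... | C Σ., ih = C + p * p Σ., λ e → begin
      moment e (d ℕ.+ m ℕ.* d) J            ≡⟨ ≡.cong (λ n → moment e n J) (ℕ.+-comm d (m ℕ.* d)) ⟩
      moment e (m ℕ.* d ℕ.+ d) J            ≈⟨ ∑-++ (m ℕ.* d) d _ ⟩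
      moment e (m ℕ.* d) J + ∑ d (λ k → (ζ ^ (m ℕ.* d ℕ.+ k)) ^ e * (binom (m ℕ.* d ℕ.+ k) J * binom (m ℕ.* d ℕ.+ k) J))
        ≈⟨ +-cong (ih e) (∑-cong d (λ k k<d → trans
             (*-cong (^-congˡ e (ζ^-periodic m k)) (*-cong (lucas m k j j₀ k<d j₀<d) (lucas m k j j₀ k<d j₀<d)))
             (solve 3 (λ w p b → w :* ((p :* b) :* (p :* b)) := p :* p :* (w :* (b :* b))) refl _ p _))) ⟩
      C * moment e d j₀ + ∑ d (λ k → p * p * ((ζ ^ k) ^ e * (binom k j₀ * binom k j₀)))
        ≈⟨ +-congˡ (*-distribˡ-∑ d (p * p) (λ k → (ζ ^ k) ^ e * (binom k j₀ * binom k j₀))) ⟨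
      C * moment e d j₀ + p * p * moment e d j₀
        ≈⟨ distribʳ _ C (p * p) ⟨
      (C + p * p) * moment e d j₀           ∎
      where
      J = j ℕ.* d ℕ.+ j₀
      p = pascal m j

    -- The remainder b of j modulo d satisfies 2 b ≥ d, 2 b + 2 < d, 2 b + 2 = d or 2 b + 1 = d.
    data Residue (m j : ℕ) : Set ℓ where
      central≈0 : binom (2 ℕ.* j) j ≈ 0# → Residue m j
      below     : moment 1 (m ℕ.* d) j ≈ 0# → moment 2 (m ℕ.* d) j ≈ 0# →
                  ∀ i → 0 ℕ.< i → i ℕ.< d → ζ ^ suc j ≈ ζ ^ i → Residue m j
      even-half : ∀ i → suc (suc (i ℕ.+ i)) ≡ d →
                  moment 1 (m ℕ.* d) j ≈ 0# → ζ ^ (2 ℕ.* suc j) ≈ 1# → Residue m j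
      odd-half  : ∀ i → suc (i ℕ.+ i) ≡ d →
                  (1# - ζ) * moment 2 (m ℕ.* d) j
                  + ((1# - ζ ^ i) * moment 1 (m ℕ.* d) j + (1# - ζ ^ i) * moment 1 (m ℕ.* d) j) ≈ 0# →
                  Residue m j

    residue′ : ∀ m a b → b ℕ.< d → Residue m (a ℕ.* d ℕ.+ b)
    residue′ m a b b<d with ℕ.<-cmp (suc (b ℕ.+ b)) d
    ... | tri≈ _ 1+2b≡d _ = odd-half b 1+2b≡d (begin
      (1# - ζ) * N₂ + ((1# - ζ ^ b) * N₁ + (1# - ζ ^ b) * N₁)
        ≈⟨ +-cong (*-congˡ (eq 2)) (+-cong (*-congˡ (eq 1)) (*-congˡ (eq 1))) ⟩
      (1# - ζ) * (C * M₂) + ((1# - ζ ^ b) * (C * M₁) + (1# - ζ ^ b) * (C * M₁))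
        ≈⟨ solve 5 (λ c z w x y → (:1 :- z) :* (c :* y) :+ ((:1 :- w) :* (c :* x) :+ (:1 :- w) :* (c :* x))
                    := c :* ((:1 :- z) :* y :+ ((:1 :- w) :* x :+ (:1 :- w) :* x)))
                 refl C ζ (ζ ^ b) M₁ M₂ ⟩
      C * ((1# - ζ) * M₂ + ((1# - ζ ^ b) * M₁ + (1# - ζ ^ b) * M₁))    ≈⟨ *-congˡ (moment-relation b 1+2b≡d) ⟩
      C * 0#                                                           ≈⟨ zeroʳ C ⟩
      0#                                                               ∎)
      where
      C = proj₁ (moment-periods m a b b<d)
      eq = proj₂ (moment-periods m a b b<d)
      N₁ = moment 1 (m ℕ.* d) (a ℕ.* d ℕ.+ b)
      N₂ = moment 2 (m ℕ.* d) (a ℕ.* d ℕ.+ b)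
      M₁ = moment 1 d b
      M₂ = moment 2 d b
    ... | tri> _ _ d<1+2b = central≈0 (begin
      binom (2 ℕ.* J) J                                   ≡⟨ ≡.cong (λ n → binom n J) 2J≡ ⟩
      binom ((a ℕ.+ a ℕ.+ 1) ℕ.* d ℕ.+ r) J               ≈⟨ lucas (a ℕ.+ a ℕ.+ 1) r a b (ℕ.<-trans r<b b<d) b<d ⟩
      pascal (a ℕ.+ a ℕ.+ 1) a * binom r b                ≈⟨ *-congˡ (binom-< r b r<b) ⟩
      pascal (a ℕ.+ a ℕ.+ 1) a * 0#                       ≈⟨ zeroʳ _ ⟩
      0#                                                  ∎)
      where
      J = a ℕ.* d ℕ.+ b
      d≤2b : d ℕ.≤ b ℕ.+ b
      d≤2b = ℕ.≤-pred d<1+2b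
      -- Doubling j produces a carry, and the new remainder r = 2 b - d is less than b because b <
      -- d. Hence q-Lucas contributes the factor [r choose b] = 0.
      r = b ℕ.+ b ℕ.∸ d
      d+r≡2b : d ℕ.+ r ≡ b ℕ.+ b
      d+r≡2b = ℕ.m+[n∸m]≡n d≤2b
      r<b : r ℕ.< b
      r<b = ℕ.+-cancelˡ-< d r b (≡.subst (ℕ._< d ℕ.+ b) (≡.sym d+r≡2b) (ℕ.+-monoˡ-< b b<d))
      2J≡ : 2 ℕ.* J ≡ (a ℕ.+ a ℕ.+ 1) ℕ.* d ℕ.+ r
      2J≡ = ≡.trans (solve-ℕ 3 (λ a d b → con-ℕ 2 ⊗ (a ⊗ d ⊕ b) ⊜ (a ⊗ d ⊕ a ⊗ d) ⊕ (b ⊕ b)) ≡.refl a d b)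
        (≡.trans (≡.cong (λ n → (a ℕ.* d ℕ.+ a ℕ.* d) ℕ.+ n) (≡.sym d+r≡2b))
          (solve-ℕ 3 (λ a d r → (a ⊗ d ⊕ a ⊗ d) ⊕ (d ⊕ r) ⊜ (a ⊕ a ⊕ con-ℕ 1) ⊗ d ⊕ r) ≡.refl a d r))
        where open +-*-Solver renaming (solve to solve-ℕ; con to con-ℕ; _:*_ to _⊗_; _:+_ to _⊕_; _:=_ to _⊜_)
    ... | tri< 1+2b<d _ _ = helper (ℕ.m≤n⇒m<n∨m≡n 1+2b<d)
      where
      C = proj₁ (moment-periods m a b b<d)
      eq = proj₂ (moment-periods m a b b<d)
      vanish : ∀ e → moment e d b ≈ 0# → moment e (m ℕ.* d) (a ℕ.* d ℕ.+ b) ≈ 0#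
      vanish e M≈0 = trans (eq e) (trans (*-congˡ M≈0) (zeroʳ C))
      M₁≈0 = vanish 1 (moment≈0 1 b ℕ.z<s 1+2b<d)
      helper : suc (suc (b ℕ.+ b)) ℕ.< d ⊎ suc (suc (b ℕ.+ b)) ≡ d → Residue m (a ℕ.* d ℕ.+ b)
      -- Modulo d the exponent j + 1 is b + 1, which lies strictly between 0 and d, so that 1 - ζ ^
      -- (j + 1) is cancellable.
      helper (inj₁ 2+2b<d) = below M₁≈0 (vanish 2 (moment≈0 2 b ℕ.z<s 2+2b<d)) (suc b) ℕ.z<s
        (ℕ.≤-<-trans (ℕ.s≤s (ℕ.≤-trans (ℕ.m≤m+n b b) (ℕ.n≤1+n _))) 2+2b<d)
        (trans (^-congʳ ζ (≡.sym (ℕ.+-suc (a ℕ.* d) b))) (ζ^-periodic a (suc b)))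
      helper (inj₂ 2+2b≡d) = even-half b 2+2b≡d M₁≈0 (begin
        ζ ^ (2 ℕ.* suc (a ℕ.* d ℕ.+ b))              ≈⟨ ^-congʳ ζ 2[1+J]≡ ⟩
        ζ ^ ((a ℕ.+ a) ℕ.* d ℕ.+ d)                  ≈⟨ ζ^-periodic (a ℕ.+ a) d ⟩
        ζ ^ d                                        ≈⟨ ζ^d≈1 ⟩
        1#                                           ∎)
        where
        2[1+J]≡ : 2 ℕ.* suc (a ℕ.* d ℕ.+ b) ≡ (a ℕ.+ a) ℕ.* d ℕ.+ d
        2[1+J]≡ = ≡.trans
          (solve-ℕ 3 (λ a d b → con-ℕ 2 ⊗ (con-ℕ 1 ⊕ (a ⊗ d ⊕ b)) ⊜ (a ⊕ a) ⊗ d ⊕ (con-ℕ 2 ⊕ (b ⊕ b))) ≡.refl a d b)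
          (≡.cong (λ n → (a ℕ.+ a) ℕ.* d ℕ.+ n) 2+2b≡d)
          where open +-*-Solver renaming (solve to solve-ℕ; con to con-ℕ; _:*_ to _⊗_; _:+_ to _⊕_; _:=_ to _⊜_)

    residue : ∀ m j → Residue m j
    residue m j = ≡.subst (Residue m) (≡.sym (≡.trans (m≡m%n+[m/n]*n j d) (ℕ.+-comm (j % d) _)))
      (residue′ m (j / d) (j % d) (m%n<n j d))

    -- `p` and `B` represent the powers and the binomials of the theorem. They are given only up to
    -- equality, so no long division has to be unfolded here, and one development serves both bases
    -- q and q ^ 2.
    module CoefficientSums
      (p : ℕ → Carrier) (B : ℕ → ℕ → Carrier)
      (p≈ : ∀ k → p k ≈ ζ ^ k) (B≈ : ∀ k j → B k j ≈ binom k j)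
      (m j : ℕ)
      where

      n = m ℕ.* d
      c₀ = B (2 ℕ.* j) j
      c₀≈ = B≈ (2 ℕ.* j) j
      M₁ = moment 1 n j
      M₂ = moment 2 n j

      sum-B² : ∑ n (λ k → p k * (B k j ^ 2 * c₀)) ≈ c₀ * M₁
      sum-B² = trans
        (∑-cong n λ k _ → trans
          (*-cong (p≈ k) (*-congʳ (^-congˡ 2 (B≈ k j))))
          (solve 3 (λ w b c → w :* (b :* (b :* :1) :* c) := c :* (w :* :1 :* (b :* b))) refl (ζ ^ k) (binom k j) c₀))
        (sym (*-distribˡ-∑ n c₀ _))

      -- `N k` is the q-integer [k + 1], known through its defining equation. The factor 1 - ζ turns
      -- it into 1 - ζ z with z = ζ ^ k, which splits the sum into the two moments.
      1-ζ*sum-B²N : (N : ℕ → Carrier) → (∀ k → (1# - ζ) * N k ≈ 1# - ζ ^ suc k) →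
        (1# - ζ) * ∑ n (λ k → (p k * N k) * (B k j ^ 2 * c₀)) ≈ c₀ * (M₁ - ζ * M₂)
      1-ζ*sum-B²N N N≈ = begin
        (1# - ζ) * ∑ n (λ k → (p k * N k) * (B k j ^ 2 * c₀))      ≈⟨ *-distribˡ-∑ n (1# - ζ) _ ⟩
        ∑ n (λ k → (1# - ζ) * ((p k * N k) * (B k j ^ 2 * c₀)))    ≈⟨ ∑-cong n (λ k _ → term k) ⟩
        ∑ n (λ k → c₀ * t₁ k + (- (c₀ * ζ)) * t₂ k)
          ≈⟨ ∑-distrib-+ n (λ k → c₀ * t₁ k) (λ k → (- (c₀ * ζ)) * t₂ k) ⟩
        ∑ n (λ k → c₀ * t₁ k) + ∑ n (λ k → (- (c₀ * ζ)) * t₂ k)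
          ≈⟨ +-cong (*-distribˡ-∑ n c₀ t₁) (*-distribˡ-∑ n (- (c₀ * ζ)) t₂) ⟨
        c₀ * M₁ + (- (c₀ * ζ)) * M₂
          ≈⟨ solve 4 (λ c z x y → c :* x :+ :- (c :* z) :* y := c :* (x :- z :* y)) refl c₀ ζ M₁ M₂ ⟩
        c₀ * (M₁ - ζ * M₂)                                         ∎
        where
        t₁ t₂ : ℕ → Carrier
        t₁ k = (ζ ^ k) ^ 1 * (binom k j * binom k j)
        t₂ k = (ζ ^ k) ^ 2 * (binom k j * binom k j)
        term : ∀ k → (1# - ζ) * ((p k * N k) * (B k j ^ 2 * c₀)) ≈ c₀ * t₁ k + (- (c₀ * ζ)) * t₂ k
        term k = begin
          (1# - ζ) * ((p k * N k) * (B k j ^ 2 * c₀))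
            ≈⟨ *-congˡ (*-cong (*-congʳ (p≈ k)) (*-congʳ (^-congˡ 2 (B≈ k j)))) ⟩
          (1# - ζ) * ((ζ ^ k * N k) * (binom k j ^ 2 * c₀))
            ≈⟨ solve 5 (λ z w n b c → (:1 :- z) :* ((w :* n) :* (b :* (b :* :1) :* c))
                        := ((:1 :- z) :* n) :* (w :* (b :* b :* c))) refl ζ (ζ ^ k) (N k) (binom k j) c₀ ⟩
          ((1# - ζ) * N k) * (ζ ^ k * (binom k j * binom k j * c₀))    ≈⟨ *-congʳ (N≈ k) ⟩
          (1# - ζ * ζ ^ k) * (ζ ^ k * (binom k j * binom k j * c₀))
            ≈⟨ solve 4 (λ z w b c → (:1 :- z :* w) :* (w :* (b :* b :* c))
                        := c :* (w :* :1 :* (b :* b)) :+ (:- (c :* z)) :* (w :* (w :* :1) :* (b :* b)))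
                     refl ζ (ζ ^ k) (binom k j) c₀ ⟩
          c₀ * t₁ k + (- (c₀ * ζ)) * t₂ k ∎

      c₀*≈0 : ∀ a → binom (2 ℕ.* j) j ≈ 0# → c₀ * a ≈ 0#
      c₀*≈0 a e = trans (*-congʳ (trans c₀≈ e)) (zeroˡ a)

      *≈0 : ∀ a {b} → b ≈ 0# → a * b ≈ 0#
      *≈0 a e = trans (*-congˡ e) (zeroʳ a)

      sum-B²≈0 : (∀ i → suc (i ℕ.+ i) ≢ d) → ∑ n (λ k → p k * (B k j ^ 2 * c₀)) ≈ 0#
      sum-B²≈0 d≢odd = trans sum-B² (cases (residue m j))
        where
        cases : Residue m j → c₀ * M₁ ≈ 0#
        cases (central≈0 c≈0)         = c₀*≈0 M₁ c≈0
        cases (below M₁≈0 _ _ _ _ _)  = *≈0 c₀ M₁≈0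
        cases (even-half _ _ M₁≈0 _)  = *≈0 c₀ M₁≈0
        cases (odd-half i 1+2i≡d _)   = contradiction 1+2i≡d (d≢odd i)

      mixed-sum≈0 : (∀ i → suc (i ℕ.+ i) ≢ d) → 2 ℕ.< d →
        ∀ N → (1# - ζ ^ 2) * N ≈ 1# - (ζ ^ 2) ^ suc j →
        N * c₀ * ∑ n (λ k → p k * B k j * B (suc k) (suc j)) ≈ 0#
      mixed-sum≈0 d≢odd 2<d N N≈ = cases (residue m j)
        where
        T = ∑ n (λ k → p k * B k j * B (suc k) (suc j))

        -- Absorption replaces [k + 1 choose j + 1] by (1 - ζ ^ (k + 1)) [k choose j], so a square
        -- of [k choose j] appears and T is expressed by moments.
        [1-ζ^1+j]*T : (1# - ζ ^ suc j) * T ≈ M₁ - ζ * M₂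
        [1-ζ^1+j]*T = begin
          (1# - ζ ^ suc j) * T                                          ≈⟨ *-distribˡ-∑ n _ _ ⟩
          ∑ n (λ k → (1# - ζ ^ suc j) * (p k * B k j * B (suc k) (suc j))) ≈⟨ ∑-cong n (λ k _ → term k) ⟩
          ∑ n (λ k → t₁ k + (- ζ) * t₂ k)                               ≈⟨ ∑-distrib-+ n t₁ (λ k → (- ζ) * t₂ k) ⟩
          M₁ + ∑ n (λ k → (- ζ) * t₂ k)                                 ≈⟨ +-congˡ (*-distribˡ-∑ n (- ζ) t₂) ⟨
          M₁ + (- ζ) * M₂
            ≈⟨ solve 3 (λ z x y → x :+ (:- z) :* y := x :- z :* y) refl ζ M₁ M₂ ⟩
          M₁ - ζ * M₂                                                   ∎
          where
          t₁ t₂ : ℕ → Carrier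
          t₁ k = (ζ ^ k) ^ 1 * (binom k j * binom k j)
          t₂ k = (ζ ^ k) ^ 2 * (binom k j * binom k j)
          term : ∀ k → (1# - ζ ^ suc j) * (p k * B k j * B (suc k) (suc j)) ≈ t₁ k + (- ζ) * t₂ k
          term k = begin
            (1# - ζ ^ suc j) * (p k * B k j * B (suc k) (suc j))
              ≈⟨ *-congˡ (*-cong (*-cong (p≈ k) (B≈ k j)) (B≈ (suc k) (suc j))) ⟩
            (1# - ζ ^ suc j) * (ζ ^ k * binom k j * binom (suc k) (suc j))
              ≈⟨ solve 4 (λ x w b u → x :* (w :* b :* u) := w :* b :* (x :* u)) refl _ _ _ _ ⟩
            ζ ^ k * binom k j * ((1# - ζ ^ suc j) * binom (suc k) (suc j))    ≈⟨ *-congˡ (absorption k j) ⟩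
            ζ ^ k * binom k j * ((1# - ζ * ζ ^ k) * binom k j)
              ≈⟨ solve 3 (λ z w b → w :* b :* ((:1 :- z :* w) :* b)
                          := w :* :1 :* (b :* b) :+ (:- z) :* (w :* (w :* :1) :* (b :* b))) refl ζ (ζ ^ k) (binom k j) ⟩
            t₁ k + (- ζ) * t₂ k ∎

        cases : Residue m j → N * c₀ * T ≈ 0#
        cases (central≈0 c≈0) =
          trans (*-congʳ (*≈0 N (trans c₀≈ c≈0))) (zeroˡ T)
        cases (below M₁≈0 M₂≈0 i 0<i i<d ζ^1+j≈ζ^i) = *≈0 (N * c₀) (regular i 0<i i<d T (begin
          (1# - ζ ^ i) * T        ≈⟨ *-congʳ (+-congˡ (-‿cong ζ^1+j≈ζ^i)) ⟨
          (1# - ζ ^ suc j) * T    ≈⟨ [1-ζ^1+j]*T ⟩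
          M₁ - ζ * M₂             ≈⟨ +-cong M₁≈0 (-‿cong (*-congˡ M₂≈0)) ⟩
          0# - ζ * 0#             ≈⟨ solve 1 (λ z → con ℤ.0ℤ :- z :* con ℤ.0ℤ := con ℤ.0ℤ) refl ζ ⟩
          0#                      ∎))
        cases (even-half _ _ _ ζ^2+2j≈1) = trans (*-congʳ (trans (*-congʳ N≈0) (zeroˡ c₀))) (zeroˡ T)
          where
          -- M₂ has top exponent exactly d here and need not vanish. The q-integer [j + 1] in base ζ
          -- ^ 2 does: d divides 2 (j + 1), and 2 < d makes 1 - ζ ^ 2 cancellable.
          N≈0 : N ≈ 0#
          N≈0 = regular 2 ℕ.z<s 2<d N (begin
            (1# - ζ ^ 2) * N          ≈⟨ N≈ ⟩
            1# - (ζ ^ 2) ^ suc j      ≈⟨ +-congˡ (-‿cong (trans (^-assocʳ ζ 2 (suc j)) ζ^2+2j≈1)) ⟩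
            1# - 1#                   ≈⟨ -‿inverseʳ 1# ⟩
            0#                        ∎)
        cases (odd-half i 1+2i≡d _) = contradiction 1+2i≡d (d≢odd i)

      -- The square root r of ζ gives the factorisation 1 - ζ = (1 - r) (1 + r), through which the
      -- weight (1 + r) ^ 2 interacts with the moment relation. After scaling by 1 - ζ, both sides
      -- are combinations of M₁ and M₂ and the claim is that c₀ X vanishes.
      weighted-sums : (∀ i → suc (suc (i ℕ.+ i)) ≢ d) →
        ∀ r → ζ ≈ r ^ 2 → r ^ d ≈ 1# → (∀ a → (1# - r) * a ≈ 0# → a ≈ 0#) →
        (N : ℕ → Carrier) → (∀ k → (1# - ζ) * N k ≈ 1# - ζ ^ suc k) →
        (1# + r) ^ 2 * ∑ n (λ k → (p k * N k) * (B k j ^ 2 * c₀)) ≈ ∑ n (λ k → p k * (B k j ^ 2 * c₀))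
      weighted-sums d≢even r ζ≈r² r^d≈1 1-r-regular N N≈ = begin
        (1# + r) ^ 2 * S′                 ≈⟨ solve 2 (λ x y → x := (x :- y) :+ y) refl _ S ⟩
        ((1# + r) ^ 2 * S′ - S) + S       ≈⟨ +-congʳ (regular 1 ℕ.z<s 1<d _ (trans scaled (cases (residue m j)))) ⟩
        0# + S                            ≈⟨ +-identityˡ S ⟩
        S                                 ∎
        where
        S′ = ∑ n (λ k → (p k * N k) * (B k j ^ 2 * c₀))
        S  = ∑ n (λ k → p k * (B k j ^ 2 * c₀))

        X = (1# + r) ^ 2 * (M₁ - ζ * M₂) - (1# - ζ) * M₁

        scaled : (1# - ζ ^ 1) * ((1# + r) ^ 2 * S′ - S) ≈ c₀ * X
        scaled = begin
          (1# - ζ * 1#) * ((1# + r) ^ 2 * S′ - S)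
            ≈⟨ solve 4 (λ z u s t → (:1 :- z :* :1) :* (u :* s :- t) := u :* ((:1 :- z) :* s) :- (:1 :- z) :* t) refl ζ _ S′ S ⟩
          (1# + r) ^ 2 * ((1# - ζ) * S′) - (1# - ζ) * S
            ≈⟨ +-cong (*-congˡ (1-ζ*sum-B²N N N≈)) (-‿cong (*-congˡ sum-B²)) ⟩
          (1# + r) ^ 2 * (c₀ * (M₁ - ζ * M₂)) - (1# - ζ) * (c₀ * M₁)
            ≈⟨ solve 5 (λ u c z x y → u :* (c :* (x :- z :* y)) :- (:1 :- z) :* (c :* x)
                        := c :* (u :* (x :- z :* y) :- (:1 :- z) :* x)) refl _ c₀ ζ M₁ M₂ ⟩
          c₀ * X ∎

        cases : Residue m j → c₀ * X ≈ 0#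
        cases (central≈0 c≈0) = c₀*≈0 X c≈0
        cases (below M₁≈0 M₂≈0 _ _ _ _) = *≈0 c₀ (begin
          (1# + r) ^ 2 * (M₁ - ζ * M₂) - (1# - ζ) * M₁
            ≈⟨ +-cong (*-congˡ (+-cong M₁≈0 (-‿cong (*-congˡ M₂≈0)))) (-‿cong (*-congˡ M₁≈0)) ⟩
          (1# + r) ^ 2 * (0# - ζ * 0#) - (1# - ζ) * 0#
            ≈⟨ solve 2 (λ u z → u :* (con ℤ.0ℤ :- z :* con ℤ.0ℤ) :- (:1 :- z) :* con ℤ.0ℤ := con ℤ.0ℤ) refl _ ζ ⟩
          0# ∎)
        cases (even-half i 2+2i≡d _ _) = contradiction 2+2i≡d (d≢even i)
        -- Times 1 - r, X splits into a multiple of the moment relation and the remainder 2 (1 + r)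
        -- (r - r ^ 2 w) M₁. The remainder vanishes since r ^ 2 w = r ^ (2 i + 2) = r ^ (d + 1) = r.
        cases (odd-half i 1+2i≡d relation) = *≈0 c₀ (1-r-regular X (begin
          (1# - r) * X
            ≈⟨ *-congˡ (+-cong (*-congˡ (+-congˡ (-‿cong (*-congʳ ζ≈r²)))) (-‿cong (*-congʳ (+-congˡ (-‿cong ζ≈r²))))) ⟩
          (1# - r) * ((1# + r) ^ 2 * (M₁ - r ^ 2 * M₂) - (1# - r ^ 2) * M₁)
            ≈⟨ solve 4 (λ r w x y →
                 let r² = r :* (r :* :1) in
                 (:1 :- r) :* ((:1 :+ r) :* ((:1 :+ r) :* :1) :* (x :- r² :* y) :- (:1 :- r²) :* x)
                 := (:1 :+ r) :* ((r :- r² :* w) :* (x :+ x)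
                                  :- r² :* ((:1 :- r²) :* y :+ ((:1 :- w) :* x :+ (:1 :- w) :* x))))
               refl r w M₁ M₂ ⟩
          (1# + r) * ((r - r ^ 2 * w) * (M₁ + M₁)
                      - r ^ 2 * ((1# - r ^ 2) * M₂ + ((1# - w) * M₁ + (1# - w) * M₁)))
            ≈⟨ *-congˡ (+-cong (*-congʳ (+-congˡ (-‿cong r²w≈r))) (-‿cong (*-congˡ (+-congʳ (*-congʳ (+-congˡ (-‿cong (sym ζ≈r²)))))))) ⟩
          (1# + r) * ((r - r) * (M₁ + M₁)
                      - r ^ 2 * ((1# - ζ) * M₂ + ((1# - w) * M₁ + (1# - w) * M₁)))
            ≈⟨ *-congˡ (+-congˡ (-‿cong (*-congˡ relation))) ⟩
          (1# + r) * ((r - r) * (M₁ + M₁) - r ^ 2 * 0#)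
            ≈⟨ solve 2 (λ r x → (:1 :+ r) :* ((r :- r) :* (x :+ x) :- r :* (r :* :1) :* con ℤ.0ℤ) := con ℤ.0ℤ) refl r M₁ ⟩
          0# ∎))
          where
          w = ζ ^ i
          r²w≈r : r ^ 2 * w ≈ r
          r²w≈r = begin
            r ^ 2 * ζ ^ i            ≈⟨ *-congˡ (^-congˡ i ζ≈r²) ⟩
            r ^ 2 * (r ^ 2) ^ i      ≈⟨ *-congˡ (^-assocʳ r 2 i) ⟩
            r ^ 2 * r ^ (2 ℕ.* i)    ≈⟨ ^-homo-* r 2 (2 ℕ.* i) ⟨
            r ^ suc (suc (i ℕ.+ (i ℕ.+ 0)))    ≡⟨ ≡.cong (λ k → r * r ^ suc (i ℕ.+ k)) (ℕ.+-identityʳ i) ⟩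
            r * r ^ suc (i ℕ.+ i)    ≡⟨ ≡.cong (λ k → r * r ^ k) 1+2i≡d ⟩
            r * r ^ d                ≈⟨ *-congˡ r^d≈1 ⟩
            r * 1#                   ≈⟨ *-identityʳ r ⟩
            r                        ∎

-- Congruences

2∣1+2i⇒⊥ : ∀ {d} i → 2 ℕ.∣ d → suc (i ℕ.+ i) ≢ d
2∣1+2i⇒⊥ i 2∣d ≡.refl = contradiction
  (ℕ.∣m+n∣m⇒∣n (≡.subst (2 ℕ.∣_) (ℕ.+-comm 1 (i ℕ.+ i)) 2∣d) 2∣i+i) (ℕ.>⇒∤ (ℕ.s≤s (ℕ.s≤s ℕ.z≤n)))
  where
  2∣i+i : 2 ℕ.∣ (i ℕ.+ i)
  2∣i+i = ℕ.divides i (≡.trans (≡.cong (i ℕ.+_) (≡.sym (ℕ.+-identityʳ i))) (ℕ.*-comm 2 i))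

2∤d⇒2+2i≢d : ∀ {d} i → ¬ 2 ℕ.∣ d → suc (suc (i ℕ.+ i)) ≢ d
2∤d⇒2+2i≢d i 2∤d 2+2i≡d = 2∤d (ℕ.divides (suc i) (≡.trans (≡.sym 2+2i≡d) (2+2i≡ i)))
  where
  2+2i≡ : ∀ i → suc (suc (i ℕ.+ i)) ≡ suc i ℕ.* 2
  2+2i≡ zero    = ≡.refl
  2+2i≡ (suc i) = ≡.cong (λ n → suc (suc n))
    (≡.trans (≡.cong suc (ℕ.+-suc i i)) (2+2i≡ i))

-- A multiple of d strictly between 0 and 2 d is d itself, and d = 2 i contradicts oddness.
odd⇒d∤2i : ∀ {d i} → ¬ 2 ℕ.∣ d → 0 ℕ.< i → i ℕ.< d → ¬ d ℕ.∣ 2 ℕ.* i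
odd⇒d∤2i {d} {suc i} 2∤d _ i<d (ℕ.divides 1 eq) =
  2∤d (ℕ.divides (suc i) (≡.trans (≡.trans (≡.sym (ℕ.+-identityʳ d)) (≡.sym eq)) (ℕ.*-comm 2 (suc i))))
odd⇒d∤2i {d} {suc i} 2∤d _ i<d (ℕ.divides (suc (suc k)) eq) =
  ℕ.<⇒≢ (ℕ.<-≤-trans (ℕ.*-monoʳ-< 2 i<d) (ℕ.*-monoˡ-≤ d {2} {suc (suc k)} (ℕ.s≤s (ℕ.s≤s ℕ.z≤n)))) eq

module Congruence {c ℓ} (R : CommutativeRing c ℓ) where

  open CommutativeRing R
  open SemiringExp semiring using (_^_; ^-assocʳ)
  open FiniteSums R using (∑)

  -- An abstract relation instead of Quotient keeps conversion checking from unfolding ring laws.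
  module _ {ℓ′} (Congruent : Carrier → Carrier → Set ℓ′)
    (isCommutativeRing-≋ : IsCommutativeRing Congruent _+_ _*_ -_ 0# 1#)
    (≈⇒≋ : ∀ {a b} → a ≈ b → Congruent a b)
    (q : Carrier) (d′ : ℕ) (1<d : 1 ℕ.< suc d′) (q^d≋1 : Congruent (q ^ suc d′) 1#)
    (1-q^i-regular : ∀ i → ¬ suc d′ ℕ.∣ i → ∀ a → Congruent ((1# - q ^ i) * a) 0# → Congruent a 0#)
    where

    private
      d = suc d′

      infix 4 _≋_
      _≋_ = Congruent

      congruenceRing : CommutativeRing c ℓ′
      congruenceRing = record { isCommutativeRing = isCommutativeRing-≋ }

      module A = CommutativeRing congruenceRing
      module A^ = SemiringExp A.semiring

    -- The two rings share their multiplication, but their powers are separate recursions, so they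
    -- have to be identified by induction.
    ^-congruence : ∀ a k → a A^.^ k ≡ a ^ k
    ^-congruence a zero    = ≡.refl
    ^-congruence a (suc k) = ≡.cong (a *_) (^-congruence a k)

    ^≋ : ∀ {a b} k → a ≈ b ^ k → a ≋ b A^.^ k
    ^≋ {b = b} k a≈b^k = A.trans (≈⇒≋ a≈b^k) (A.reflexive (≡.sym (^-congruence b k)))

    1-^≋ : ∀ a k → 1# - a ^ k ≋ 1# - a A^.^ k
    1-^≋ a k = A.+-congˡ {1#} (A.-‿cong (^≋ k refl))

    binom-congruence : ∀ Q k j → GaussianBinomial.binom congruenceRing Q k j ≡ GaussianBinomial.binom R Q k j
    binom-congruence Q k       zero    = ≡.refl
    binom-congruence Q zero    (suc j) = ≡.refl
    binom-congruence Q (suc k) (suc j) = ≡.cong₂ _+_ (binom-congruence Q k j)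
      (≡.cong₂ _*_ (^-congruence Q (suc j)) (binom-congruence Q k (suc j)))

    binom≋ : ∀ {a} Q k j → a ≈ GaussianBinomial.binom R Q k j →
             a ≋ GaussianBinomial.binom congruenceRing Q k j
    binom≋ Q k j a≈ = A.trans (≈⇒≋ a≈) (A.reflexive (≡.sym (binom-congruence Q k j)))

    q^d≋1′ : q A^.^ d ≋ 1#
    q^d≋1′ = A.trans (A.sym (^≋ d refl)) q^d≋1

    0<i<d⇒d∤i : ∀ {i} → 0 ℕ.< i → i ℕ.< d → ¬ d ℕ.∣ i
    0<i<d⇒d∤i 0<i i<d = ℕ.>⇒∤ {{ℕ.>-nonZero 0<i}} i<d

    q-regular : ∀ i → 0 ℕ.< i → i ℕ.< d → ∀ a → (1# - q A^.^ i) * a ≋ 0# → a ≋ 0#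
    q-regular i 0<i i<d a e = 1-q^i-regular i (0<i<d⇒d∤i 0<i i<d) a
      (A.trans (A.*-congʳ {a} (1-^≋ q i)) e)

    -- Doubling permutes the nonzero residues modulo an odd d, so `q ^ 2` can take the role of ζ.
    q²-regular : ¬ 2 ℕ.∣ d → ∀ i → 0 ℕ.< i → i ℕ.< d → ∀ a → (1# - (q ^ 2) A^.^ i) * a ≋ 0# → a ≋ 0#
    q²-regular 2∤d i 0<i i<d a e = 1-q^i-regular (2 ℕ.* i) (odd⇒d∤2i 2∤d 0<i i<d) a
      (A.trans (A.*-congʳ {a} (A.+-congˡ {1#} (A.-‿cong (^≋ i (sym (^-assocʳ q 2 i)))))) e)

    [q²]^d≋1 : (q ^ 2) A^.^ d ≋ 1#
    [q²]^d≋1 = A.trans (A^.^-assocʳ q 2 d) (A.trans (A^.^-homo-* q d _)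
      (A.trans (A.*-cong q^d≋1′ (A.trans (A^.^-congʳ q (ℕ.+-identityʳ d)) q^d≋1′)) (A.*-identityˡ 1#)))

    module _ (p : ℕ → Carrier) (B : ℕ → ℕ → Carrier)
             (p≈ : ∀ k → p k ≈ q ^ k) (B≈ : ∀ k j → B k j ≈ GaussianBinomial.binom R q k j) where

      sum-B²≋0 : 2 ℕ.∣ d → ∀ m j → ∑ (m ℕ.* d) (λ k → p k * (B k j ^ 2 * B (2 ℕ.* j) j)) ≋ 0#
      sum-B²≋0 2∣d m j = RootOfUnity.CoefficientSums.sum-B²≈0
        congruenceRing q d′ 1<d q^d≋1′ q-regular p B (λ k → ^≋ k (p≈ k)) (λ k j → binom≋ q k j (B≈ k j)) m j
        (λ i → 2∣1+2i⇒⊥ i 2∣d)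

      mixed-sum≋0 : 2 ℕ.∣ d → 2 ℕ.< d → ∀ m j N → (1# - q ^ 2) * N ≈ 1# - (q ^ 2) ^ suc j →
        N * B (2 ℕ.* j) j * ∑ (m ℕ.* d) (λ k → p k * B k j * B (suc k) (suc j)) ≋ 0#
      mixed-sum≋0 2∣d 2<d m j N N≈ = RootOfUnity.CoefficientSums.mixed-sum≈0
        congruenceRing q d′ 1<d q^d≋1′ q-regular p B (λ k → ^≋ k (p≈ k)) (λ k j → binom≋ q k j (B≈ k j)) m j
        (λ i → 2∣1+2i⇒⊥ i 2∣d) 2<d N (A.trans (≈⇒≋ N≈) (1-^≋ (q ^ 2) (suc j)))

    weighted-sums≋ :
      (p : ℕ → Carrier) (B : ℕ → ℕ → Carrier)
      (p≈ : ∀ k → p k ≈ (q ^ 2) ^ k) (B≈ : ∀ k j → B k j ≈ GaussianBinomial.binom R (q ^ 2) k j)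
      (N : ℕ → Carrier) (N≈ : ∀ k → (1# - q ^ 2) * N k ≈ 1# - (q ^ 2) ^ suc k) →
      ¬ 2 ℕ.∣ d → ∀ m j →
      (1# + q) ^ 2 * ∑ (m ℕ.* d) (λ k → (p k * N k) * (B k j ^ 2 * B (2 ℕ.* j) j))
      ≋ ∑ (m ℕ.* d) (λ k → p k * (B k j ^ 2 * B (2 ℕ.* j) j))
    weighted-sums≋ p B p≈ B≈ N N≈ 2∤d m j = RootOfUnity.CoefficientSums.weighted-sums
      congruenceRing (q ^ 2) d′ 1<d [q²]^d≋1 (q²-regular 2∤d)
      p B (λ k → ^≋ k (p≈ k)) (λ k j → binom≋ (q ^ 2) k j (B≈ k j)) m j
      (λ i → 2∤d⇒2+2i≢d i 2∤d) q A.refl q^d≋1′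
      (λ a e → q-regular 1 ℕ.z<s 1<d a
        (A.trans (A.*-congʳ {a} (A.+-congˡ {1#} (A.-‿cong (A.*-identityʳ q)))) e))
      N (λ k → A.trans (≈⇒≋ (N≈ k)) (1-^≋ (q ^ 2) (suc k)))

-- Cyclotomic polynomials

properDivisors : ℕ → List ℕ
properDivisors d = filter (ℕ._<? d) (divisors d)

divisors-increasing : ∀ n → AllPairs ℕ._<_ (divisors n)
divisors-increasing n = AllPairs.filter⁺ (ℕ._∣? n)
  (AllPairs.map⁺ (AllPairs.applyUpTo⁺₁ id n (λ i<j _ → ℕ.s≤s i<j)))

all-divisors : ∀ n → All (λ d → 0 ℕ.< d × d ℕ.∣ n) (divisors n)
all-divisors n = All.zip
  ( All.filter⁺ (ℕ._∣? n) (All.map⁺ (All.universal (λ _ → ℕ.z<s) (upTo n)))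
  Σ., All.all-filter (ℕ._∣? n) (map suc (upTo n)))

all-properDivisors : ∀ d → All (λ e → e ℕ.< d × 0 ℕ.< e × e ℕ.∣ d) (properDivisors d)
all-properDivisors d = All.zip
  (All.all-filter (ℕ._<? d) (divisors d) Σ., All.filter⁺ (ℕ._<? d) (all-divisors d))

∈-divisors : ∀ {d n} → 0 ℕ.< d → 0 ℕ.< n → d ℕ.∣ n → d ∈ divisors n
∈-divisors {suc d} {suc n} _ _ d∣n =
  ∈-filter⁺ (ℕ._∣? suc n) (∈-map⁺ suc (∈-upTo⁺ (ℕ.∣⇒≤ d∣n))) d∣n

divisors≡proper∷ʳ : ∀ d → 0 ℕ.< d → divisors d ≡ properDivisors d ++ d ∷ []
divisors≡proper∷ʳ (suc d) _ = begin
  divisors (suc d)                        ≡⟨ split ⟩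
  L ++ suc d ∷ []                         ≡⟨ ≡.cong (_++ suc d ∷ []) proper≡L ⟨
  properDivisors (suc d) ++ suc d ∷ []    ∎
  where
  open ≡.≡-Reasoning
  L = filter (ℕ._∣? suc d) (map suc (upTo d))

  split : divisors (suc d) ≡ L ++ suc d ∷ []
  split = begin
    filter (ℕ._∣? suc d) (map suc (upTo (suc d)))
      ≡⟨ ≡.cong (λ xs → filter (ℕ._∣? suc d) (map suc xs)) (List.upTo-∷ʳ d) ⟨
    filter (ℕ._∣? suc d) (map suc (upTo d ++ d ∷ []))
      ≡⟨ ≡.cong (filter (ℕ._∣? suc d)) (List.map-++ suc (upTo d) (d ∷ [])) ⟩
    filter (ℕ._∣? suc d) (map suc (upTo d) ++ suc d ∷ [])
      ≡⟨ List.filter-++ (ℕ._∣? suc d) (map suc (upTo d)) (suc d ∷ []) ⟩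
    L ++ filter (ℕ._∣? suc d) (suc d ∷ [])
      ≡⟨ ≡.cong (L ++_) (List.filter-accept (ℕ._∣? suc d) ℕ.∣-refl) ⟩
    L ++ suc d ∷ []                                       ∎

  proper≡L : properDivisors (suc d) ≡ L
  proper≡L = begin
    filter (ℕ._<? suc d) (divisors (suc d))       ≡⟨ ≡.cong (filter (ℕ._<? suc d)) split ⟩
    filter (ℕ._<? suc d) (L ++ suc d ∷ [])        ≡⟨ List.filter-++ (ℕ._<? suc d) L (suc d ∷ []) ⟩
    filter (ℕ._<? suc d) L ++ filter (ℕ._<? suc d) (suc d ∷ [])
      ≡⟨ ≡.cong₂ _++_
           (List.filter-all (ℕ._<? suc d) (All.filter⁺ (ℕ._∣? suc d)
             (All.map⁺ (All.applyUpTo⁺₁ id d (λ i<d → ℕ.s≤s i<d)))))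
           (List.filter-reject (ℕ._<? suc d) {suc d} {[]} (ℕ.<-irrefl ≡.refl)) ⟩
    L ++ []                                       ≡⟨ List.++-identityʳ L ⟩
    L                                             ∎

module CyclotomicFactors {c ℓ} (R : CommutativeRing c ℓ) where

  open CommutativeRing R
  open IntegerCoefficientSolver R
  open FiniteSums R using (∑; *-distribˡ-∑; geometric-sum)
  open SemiringDivisibility semiring
    using (_∣_; _,_; ∣ʳ-respʳ-≈; ∣ʳ-respˡ-≈; ∣ʳ-trans; x∣ʳy⇒x∣ʳzy)
  open SemiringExp semiring using (_^_; ^-congʳ; ^-homo-*; ^-assocʳ)

  module _ (q : Carrier) (Φ : ℕ → Carrier) where

    ∏ : List ℕ → Carrier
    ∏ ds = foldr _*_ 1# (map Φ ds)

    module _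
      -- Long division returns a true quotient only if it is exact, so the factorisation is
      -- conditional on divisibility, which the induction below supplies.
      (Φ-factor : ∀ d → 0 ℕ.< d → ∏ (properDivisors d) ∣ (q ^ d - 1#) →
                  Φ d * ∏ (properDivisors d) ≈ q ^ d - 1#)
      (torsion-free : ∀ d f → 0 ℕ.< d → f ∣ (q ^ d - 1#) →
                      ∀ n a → f ∣ ∑ (suc n) (λ _ → a) → f ∣ a)
      (q^d-1-regular : ∀ d → 0 ℕ.< d → ∀ a → (q ^ d - 1#) * a ≈ 0# → a ≈ 0#)
      where

      -- These facts need one strong induction. `cancel` below d makes the proper Φ e combine to a
      -- divisor of q ^ d - 1, which yields `divides` and `product` at d; `product` below d in turn
      -- is needed for `cancel` at d.
      record Cyclotomic (d : ℕ) : Set (c ⊔ ℓ) where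
        field
          positive  : 0 ℕ.< d
          divides   : Φ d ∣ (q ^ d - 1#)
          product   : ∏ (divisors d) ≈ q ^ d - 1#
          cancel    : ∀ i → ¬ d ℕ.∣ i → ∀ a → Φ d ∣ ((q ^ i - 1#) * a) → Φ d ∣ a
      open Cyclotomic

      ∏-++ : ∀ ds es → ∏ (ds ++ es) ≈ ∏ ds * ∏ es
      ∏-++ []       es = sym (*-identityˡ _)
      ∏-++ (d ∷ ds) es = trans (*-congˡ (∏-++ ds es)) (sym (*-assoc _ _ _))

      ∈⇒∣∏ : ∀ {d ds} → d ∈ ds → Φ d ∣ ∏ ds
      ∈⇒∣∏ {ds = d ∷ ds} (here ≡.refl) = ∏ ds , *-comm _ _
      ∈⇒∣∏ (there d∈ds)               = x∣ʳy⇒x∣ʳzy _ (∈⇒∣∏ d∈ds)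

      -- For d < e, e ∤ d, so Φ e may be cancelled against Φ d, a divisor of q ^ d - 1.
      ∏∣ : ∀ ds → AllPairs ℕ._<_ ds → All Cyclotomic ds → ∀ a → All (λ d → Φ d ∣ a) ds → ∏ ds ∣ a
      ∏∣ []       _            _         a _ = a , *-identityʳ a
      ∏∣ (d ∷ ds) (d<ds ∷ inc) (cd ∷ cs) a ((h , hΦ≈a) ∷ ds∣a) =
        ∣ʳ-respʳ-≈ (trans (*-comm (Φ d) h) hΦ≈a) (multiply (∏∣ ds inc cs h ds∣h))
        where
        open SetoidReasoning setoid
        multiply : ∀ {b c} → b ∣ c → Φ d * b ∣ Φ d * c
        multiply {b} {c} (u , ub≈c) = u , trans
          (solve 3 (λ u f b → u :* (f :* b) := f :* (u :* b)) refl u (Φ d) b) (*-congˡ ub≈c)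
        ds∣h : All (λ e → Φ e ∣ h) ds
        ds∣h = All.map (λ { (d<e Σ., ce Σ., Φe∣a) → cancel ce d (ℕ.>⇒∤ {{ℕ.>-nonZero (positive cd)}} d<e) h (step Φe∣a) })
                 (All.zip (d<ds Σ., All.zip (cs Σ., ds∣a)))
          where
          -- With u the cofactor of Φ d in q ^ d - 1, the product (q ^ d - 1) h equals u a, and Φ e
          -- divides a.
          step : ∀ {e} → Φ e ∣ a → Φ e ∣ ((q ^ d - 1#) * h)
          step Φe∣a with divides cd
          ... | u , uΦ≈ = ∣ʳ-respʳ-≈ (begin
            u * a              ≈⟨ *-congˡ hΦ≈a ⟨
            u * (h * Φ d)      ≈⟨ solve 3 (λ u h f → u :* (h :* f) := (u :* f) :* h) refl u h (Φ d) ⟩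
            (u * Φ d) * h      ≈⟨ *-congʳ uΦ≈ ⟩
            (q ^ d - 1#) * h   ∎) (x∣ʳy⇒x∣ʳzy u Φe∣a)

      geometric-cofactor : ∀ k m → ∑ k (λ t → (q ^ m) ^ t) * (q ^ m - 1#) ≈ q ^ (k ℕ.* m) - 1#
      geometric-cofactor k m = begin
        S * (q ^ m - 1#)       ≈⟨ solve 2 (λ s x → s :* (x :- :1) := :- ((:1 :- x) :* s)) refl S (q ^ m) ⟩
        - ((1# - q ^ m) * S)   ≈⟨ -‿cong (geometric-sum k (q ^ m)) ⟩
        - (1# - (q ^ m) ^ k)   ≈⟨ solve 1 (λ x → :- (:1 :- x) := x :- :1) refl ((q ^ m) ^ k) ⟩
        (q ^ m) ^ k - 1#       ≈⟨ +-congʳ (trans (^-assocʳ q m k) (^-congʳ q (ℕ.*-comm m k))) ⟩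
        q ^ (k ℕ.* m) - 1#     ∎
        where
        open SetoidReasoning setoid
        S = ∑ k (λ t → (q ^ m) ^ t)

      q^m-1∣q^km-1 : ∀ k m → (q ^ m - 1#) ∣ (q ^ (k ℕ.* m) - 1#)
      q^m-1∣q^km-1 k m = ∑ k (λ t → (q ^ m) ^ t) , geometric-cofactor k m

      module Step (d : ℕ) (0<d : 0 ℕ.< d) (ih : ∀ {e} → e ℕ.< d → 0 ℕ.< e → Cyclotomic e) where

        P = ∏ (properDivisors d)

        proper-cyclotomic : All (λ e → Cyclotomic e × e ℕ.∣ d) (properDivisors d)
        proper-cyclotomic = All.map
          (λ { (e<d Σ., 0<e Σ., e∣d) → ih e<d 0<e Σ., e∣d })
          (all-properDivisors d)

        -- Each Φ e divides q ^ e - 1 and therefore q ^ d - 1. `∏∣` combines these divisors, so the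
        -- division that defines Φ d is exact.
        ΦP≈ : Φ d * P ≈ q ^ d - 1#
        ΦP≈ = Φ-factor d 0<d (∏∣ (properDivisors d)
          (AllPairs.filter⁺ (ℕ._<? d) (divisors-increasing d))
          (All.map proj₁ proper-cyclotomic) _
          (All.map (λ { (ce Σ., ℕ.divides k ≡.refl) → ∣ʳ-trans (divides ce) (q^m-1∣q^km-1 k _) })
            proper-cyclotomic))

        Φ∣q^d-1 : Φ d ∣ (q ^ d - 1#)
        Φ∣q^d-1 = P , trans (*-comm P (Φ d)) ΦP≈

        open Quotient R (Φ d)
        private module A = CommutativeRing quotientRing

        module _ (a : Carrier) where

          -- The exponents k for which q ^ k fixes a modulo Φ d. They admit sums and cancellation of
          -- summands, hence Bézout combinations, with no need to cancel a itself.
          Fixes : ℕ → Set (c ⊔ ℓ)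
          Fixes k = q ^ k * a ≋ a

          fixes-shift : ∀ k l → Fixes l → q ^ (k ℕ.+ l) * a ≋ q ^ k * a
          fixes-shift k l fl = A.trans
            (≈⇒≋ (trans (*-congʳ (^-homo-* q k l)) (*-assoc _ _ _))) (A.*-congˡ fl)

          fixes-* : ∀ k l → Fixes l → Fixes (k ℕ.* l)
          fixes-* zero    l fl = ≈⇒≋ (*-identityˡ a)
          fixes-* (suc k) l fl = A.trans (fixes-shift l (k ℕ.* l) (fixes-* k l fl)) fl

          fixes-cancel : ∀ k l → Fixes l → Fixes (k ℕ.+ l) → Fixes k
          fixes-cancel k l fl fkl = A.trans (A.sym (fixes-shift k l fl)) fkl

          fixes-d : Fixes d
          fixes-d = A.trans (A.*-congʳ {a} {q ^ d} {1#} Φ∣q^d-1) (≈⇒≋ (*-identityˡ a))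

          fixes-gcd : ∀ i → Fixes i → Fixes (gcd i d)
          fixes-gcd i fi with Bézout.identity (gcd-GCD i d)
          ... | Bézout.+- x y eq = fixes-cancel (gcd i d) (y ℕ.* d) (fixes-* y d fixes-d)
                  (≡.subst Fixes (≡.sym eq) (fixes-* x i fi))
          ... | Bézout.-+ x y eq = fixes-cancel (gcd i d) (x ℕ.* i) (fixes-* x i fi)
                  (≡.subst Fixes (≡.sym eq) (fixes-* y d fixes-d))

        -- For g = gcd i d, Φ d divides H = (q ^ d - 1) / (q ^ g - 1).  Modulo Φ d, multiplication
        -- by q ^ g fixes a, hence H * a = (d / g) * a.
        module _ (i : ℕ) (d∤i : ¬ d ℕ.∣ i) (a : Carrier) (Φ∣ : Φ d ∣ ((q ^ i - 1#) * a)) where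

          open SetoidReasoning setoid

          g = gcd i d

          0<g : 0 ℕ.< g
          0<g = ℕ.n≢0⇒n>0 λ g≡0 → ℕ.<⇒≢ 0<d (≡.sym (ℕ.0∣⇒≡0 (≡.subst (ℕ._∣ d) g≡0 (gcd[m,n]∣n i d))))

          g<d : g ℕ.< d
          g<d = ℕ.≤∧≢⇒< (ℕ.∣⇒≤ {{ℕ.>-nonZero 0<d}} (gcd[m,n]∣n i d))
            (λ g≡d → d∤i (≡.subst (ℕ._∣ i) g≡d (gcd[m,n]∣m i d)))

          k = ℕ.quotient (gcd[m,n]∣n i d)

          d≡kg : d ≡ k ℕ.* g
          d≡kg = ℕ._∣_.equality (gcd[m,n]∣n i d)

          H = ∑ k (λ t → (q ^ g) ^ t)

          -- q ^ g - 1 is the product of the Φ e over all divisors e of g. As g < d, each such e is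
          -- a proper divisor of d, so its Φ e is a factor of P.
          q^g-1∣P : (q ^ g - 1#) ∣ P
          q^g-1∣P = ∣ʳ-respˡ-≈ (product (ih g<d 0<g)) (∏∣ (divisors g) (divisors-increasing g)
            (All.map (λ { (0<e Σ., e∣g) → ih (ℕ.≤-<-trans (e≤g e∣g) g<d) 0<e }) (all-divisors g)) P
            (All.map (λ { (0<e Σ., e∣g) → ∈⇒∣∏ (∈-filter⁺ (ℕ._<? d)
                            (∈-divisors 0<e 0<d (ℕ.∣-trans e∣g (gcd[m,n]∣n i d)))
                            (ℕ.≤-<-trans (e≤g e∣g) g<d)) })
              (all-divisors g)))
            where
            e≤g : ∀ {e} → e ℕ.∣ g → e ℕ.≤ g
            e≤g = ℕ.∣⇒≤ {{ℕ.>-nonZero 0<g}}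

          -- Multiplied by q ^ g - 1, both H and s Φ d become q ^ d - 1; then q ^ g - 1 is
          -- cancelled.
          Φ∣H : Φ d ∣ H
          Φ∣H with q^g-1∣P
          ... | s , s[q^g-1]≈P = s , (begin
            s * Φ d                       ≈⟨ solve 2 (λ x h → x := h :- (h :- x)) refl (s * Φ d) H ⟩
            H - (H - s * Φ d)             ≈⟨ +-congˡ (-‿cong (q^d-1-regular g 0<g _ (begin
              (q ^ g - 1#) * (H - s * Φ d)
                ≈⟨ solve 4 (λ x h s f → x :* (h :- s :* f) := h :* x :- f :* (s :* x)) refl (q ^ g - 1#) H s (Φ d) ⟩
              H * (q ^ g - 1#) - Φ d * (s * (q ^ g - 1#))
                ≈⟨ +-cong (geometric-cofactor k g) (-‿cong (*-congˡ s[q^g-1]≈P)) ⟩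
              (q ^ (k ℕ.* g) - 1#) - Φ d * P
                ≈⟨ +-cong (+-congʳ (^-congʳ q (≡.sym d≡kg))) (-‿cong ΦP≈) ⟩
              (q ^ d - 1#) - (q ^ d - 1#)    ≈⟨ -‿inverseʳ _ ⟩
              0#                             ∎))) ⟩
            H - 0#                        ≈⟨ solve 1 (λ h → h :- con ℤ.0ℤ := h) refl H ⟩
            H                             ∎)

          fixes-i : Fixes a i
          fixes-i = ∣ʳ-respʳ-≈ (solve 2 (λ x a → (x :- :1) :* a := x :* a :- a) refl (q ^ i) a) Φ∣

          H*a≋ka : a * H ≋ ∑ k (λ _ → a)
          H*a≋ka = A.trans (≈⇒≋ (*-distribˡ-∑ k a _))
            (FiniteSums.∑-cong quotientRing k (λ t _ → A.trans
              (≈⇒≋ (trans (*-comm a _) (*-congʳ (trans (^-assocʳ q g t) (^-congʳ q (ℕ.*-comm g t))))))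
              (fixes-* a t g (fixes-gcd a i fixes-i))))

          -- k is generalised to be split into cases: k = 0 would force d = 0, while `torsion-free`
          -- cancels a positive integer.
          Φ∣ka : ∀ k → d ≡ k ℕ.* g → a * ∑ k (λ t → (q ^ g) ^ t) ≋ ∑ k (λ _ → a) →
                 Φ d ∣ (a * ∑ k (λ t → (q ^ g) ^ t)) → Φ d ∣ a
          Φ∣ka zero    d≡0 _ _ = contradiction (≡.sym d≡0) (ℕ.<⇒≢ 0<d)
          Φ∣ka (suc k) _ e Φ∣aH = torsion-free d (Φ d) 0<d Φ∣q^d-1 k a
            (≋0⇒∣ (A.trans (A.sym e) (∣⇒≋0 Φ∣aH)))

          Φ∣a : Φ d ∣ a
          Φ∣a = Φ∣ka k d≡kg H*a≋ka (x∣ʳy⇒x∣ʳzy a Φ∣H)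

        step : Cyclotomic d
        step = record
          { positive = 0<d
          ; divides  = Φ∣q^d-1
          ; product  = begin
              ∏ (divisors d)                     ≡⟨ ≡.cong ∏ (divisors≡proper∷ʳ d 0<d) ⟩
              ∏ (properDivisors d ++ d ∷ [])     ≈⟨ ∏-++ (properDivisors d) (d ∷ []) ⟩
              P * (Φ d * 1#)                     ≈⟨ solve 2 (λ p f → p :* (f :* :1) := f :* p) refl P (Φ d) ⟩
              Φ d * P                            ≈⟨ ΦP≈ ⟩
              q ^ d - 1#                         ∎
          ; cancel   = Φ∣a
          }
          where open SetoidReasoning setoid

      cyclotomic : ∀ d → 0 ℕ.< d → Cyclotomic d
      cyclotomic = <-rec _ (λ d ih 0<d → Step.step d 0<d ih)

      -- A filtered list of divisors is still increasing, so `∏∣` applies and one d can be treated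
      -- at a time.
      ∏-filter-divisors-∣ : ∀ {p} {P : ℕ → Set p} (P? : Decidable P) n a →
        (∀ d → 0 ℕ.< d → d ℕ.∣ n → P d → Φ d ∣ a) → ∏ (filter P? (divisors n)) ∣ a
      ∏-filter-divisors-∣ P? n a Φ∣ = ∏∣ (filter P? (divisors n))
        (AllPairs.filter⁺ P? (divisors-increasing n))
        (All.map (λ { (0<d Σ., _) → cyclotomic _ 0<d }) (All.filter⁺ P? (all-divisors n))) a
        (All.map (λ { (pd Σ., 0<d Σ., d∣n) → Φ∣ _ 0<d d∣n pd })
          (All.zip (All.all-filter P? (divisors n) Σ., All.filter⁺ P? (all-divisors n))))

      private
        1-q^i-regular : ∀ d′ i → ¬ suc d′ ℕ.∣ i → ∀ a →
          let open Quotient R (Φ (suc d′)) in (1# - q ^ i) * a ≋ 0# → a ≋ 0#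
        1-q^i-regular d′ i d∤i a e = ∣⇒≋0 (cancel (cyclotomic (suc d′) ℕ.z<s) i d∤i a
          (∣ʳ-respʳ-≈ (solve 2 (λ x a → :- :1 :* ((:1 :- x) :* a) := (x :- :1) :* a) refl (q ^ i) a)
            (x∣ʳy⇒x∣ʳzy (- 1#) (≋0⇒∣ e))))
          where open Quotient R (Φ (suc d′))

        q^d≋1 : ∀ d′ → let open Quotient R (Φ (suc d′)) in q ^ suc d′ ≋ 1#
        q^d≋1 d′ = divides (cyclotomic (suc d′) ℕ.z<s)

      ∏∣sum-B² :
        (p : ℕ → Carrier) (B : ℕ → ℕ → Carrier)
        (p≈ : ∀ k → p k ≈ q ^ k) (B≈ : ∀ k j → B k j ≈ GaussianBinomial.binom R q k j) →
        ∀ n j → ∏ (filter (2 ℕ.∣?_) (divisors n)) ∣ ∑ n (λ k → p k * (B k j ^ 2 * B (2 ℕ.* j) j))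
      ∏∣sum-B² p B p≈ B≈ n j = ∏-filter-divisors-∣ (2 ℕ.∣?_) n _
        -- As d divides n, the range consists of m whole periods; 2 ∣ d also gives the bound 1 < d.
        λ { (suc d′) 0<d (ℕ.divides m ≡.refl) 2∣d →
              let open Quotient R (Φ (suc d′)) in
              ≋0⇒∣ (Congruence.sum-B²≋0 R _≋_ (CommutativeRing.isCommutativeRing quotientRing) ≈⇒≋
                q d′ (ℕ.∣⇒≤ 2∣d) (q^d≋1 d′) (1-q^i-regular d′) p B p≈ B≈ 2∣d m j) }

      ∏∣mixed-sum :
        (p : ℕ → Carrier) (B : ℕ → ℕ → Carrier)
        (p≈ : ∀ k → p k ≈ q ^ k) (B≈ : ∀ k j → B k j ≈ GaussianBinomial.binom R q k j) →
        ∀ n j N → (1# - q ^ 2) * N ≈ 1# - (q ^ 2) ^ suc j →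
        ∏ (filter (λ d → (2 ℕ.<? d) ×-dec (2 ℕ.∣? d)) (divisors n)) ∣
        (N * B (2 ℕ.* j) j * ∑ n (λ k → p k * B k j * B (suc k) (suc j)))
      ∏∣mixed-sum p B p≈ B≈ n j N N≈ = ∏-filter-divisors-∣ (λ d → (2 ℕ.<? d) ×-dec (2 ℕ.∣? d)) n _
        λ { (suc d′) 0<d (ℕ.divides m ≡.refl) (2<d Σ., 2∣d) →
              let open Quotient R (Φ (suc d′)) in
              ≋0⇒∣ (Congruence.mixed-sum≋0 R _≋_ (CommutativeRing.isCommutativeRing quotientRing) ≈⇒≋
                q d′ (ℕ.∣⇒≤ 2∣d) (q^d≋1 d′) (1-q^i-regular d′) p B p≈ B≈ 2∣d 2<d m j N N≈) }

      ∏∣weighted-sums :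
        (p : ℕ → Carrier) (B : ℕ → ℕ → Carrier)
        (p≈ : ∀ k → p k ≈ (q ^ 2) ^ k) (B≈ : ∀ k j → B k j ≈ GaussianBinomial.binom R (q ^ 2) k j)
        (N : ℕ → Carrier) (N≈ : ∀ k → (1# - q ^ 2) * N k ≈ 1# - (q ^ 2) ^ suc k) →
        ∀ n j → ∏ (filter (λ d → (1 ℕ.<? d) ×-dec ¬? (2 ℕ.∣? d)) (divisors n)) ∣
        ((1# + q) ^ 2 * ∑ n (λ k → (p k * N k) * (B k j ^ 2 * B (2 ℕ.* j) j))
         - ∑ n (λ k → p k * (B k j ^ 2 * B (2 ℕ.* j) j)))
      ∏∣weighted-sums p B p≈ B≈ N N≈ n j = ∏-filter-divisors-∣ (λ d → (1 ℕ.<? d) ×-dec ¬? (2 ℕ.∣? d)) n _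
        λ { (suc d′) 0<d (ℕ.divides m ≡.refl) (1<d Σ., 2∤d) →
              let open Quotient R (Φ (suc d′)) in
              Congruence.weighted-sums≋ R _≋_ (CommutativeRing.isCommutativeRing quotientRing) ≈⇒≋
                q d′ 1<d (q^d≋1 d′) (1-q^i-regular d′) p B p≈ B≈ N N≈ 2∤d m j }

-- The congruences in ℤ[x,q]

open import Defs
open PolynomialRing ℤ.+-*-commutativeRing
  using (coeff-+; coeff-neg; coeff-•; coeff-*-zero; *ₚ-congˡ; *ₚ-cong; *ₚ-comm; •-*-assoc; _•ₚ_)
open Division using (÷-correct)
open ConstantUnit ℤ.+-*-commutativeRing using (scalar-∣-cofactor)
open SemiringDivisibility (CommutativeRing.semiring ℤ[q]-ring) using (_,_)
private module ℤ[q] = CommutativeRing ℤ[q]-ring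
open FiniteSums ℤ[q]-ring using (∑; ∑-cong; geometric-sum; δ; ∑-δ-<; ∑-δ-≥; ∑-leading-zeros)

-- Exactness of the divisions in ℤ[q]

coeff-1-^ : ∀ Q n → coeffq Q 0 ≡ ℤ.0ℤ → coeffq (1# - Q ^ suc n) 0 ≡ ℤ.1ℤ
coeff-1-^ Q n Q₀≡0 = begin
  coeffq (1# - Q ^ suc n) 0                    ≡⟨ coeff-+ 1# (- (Q ^ suc n)) 0 ⟩
  ℤ.1ℤ ℤ.+ coeffq (- (Q * Q ^ n)) 0            ≡⟨ ≡.cong (λ c → ℤ.1ℤ ℤ.+ c) (coeff-neg (Q * Q ^ n) 0) ⟩
  ℤ.1ℤ ℤ.- coeffq (Q * Q ^ n) 0                ≡⟨ ≡.cong (λ c → ℤ.1ℤ ℤ.- c) (coeff-*-zero Q (Q ^ n)) ⟩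
  ℤ.1ℤ ℤ.- coeffq Q 0 ℤ.* coeffq (Q ^ n) 0     ≡⟨ ≡.cong (λ c → ℤ.1ℤ ℤ.- c ℤ.* coeffq (Q ^ n) 0) Q₀≡0 ⟩
  ℤ.1ℤ                                         ∎
  where open ≡.≡-Reasoning

coeff-∏≡1 : ∀ n (f : ℕ → ℤ[q]) → (∀ i → coeffq (f i) 0 ≡ ℤ.1ℤ) → coeffq (sumTo _*_ 1# n f) 0 ≡ ℤ.1ℤ
coeff-∏≡1 zero    f f₀≡1 = ≡.refl
coeff-∏≡1 (suc n) f f₀≡1 = ≡.trans (coeff-*-zero (f 0) _)
  (≡.cong₂ ℤ._*_ (f₀≡1 0) (coeff-∏≡1 n (λ i → f (suc i)) (λ i → f₀≡1 (suc i))))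

square≡1 : ∀ {a} → a ≡ ℤ.1ℤ → a ℤ.* a ≡ ℤ.1ℤ
square≡1 ≡.refl = ≡.refl

q-integer-correct : ∀ Q n → coeffq Q 0 ≡ ℤ.0ℤ → (1# - Q) * [ n ]⟨ Q ⟩ ≈ 1# - Q ^ n
q-integer-correct Q n Q₀≡0 i = ≡.trans
  (*ₚ-congˡ (1# - Q) ([ n ]⟨ Q ⟩) S
    (÷-correct (1# - Q ^ n) (1# - Q) S (square≡1 unit) (geometric-sum n Q)) i)
  (geometric-sum n Q i)
  where
  S = ∑ n (Q ^_)
  unit : coeffq (1# - Q) 0 ≡ ℤ.1ℤ
  unit = ≡.trans (coeff-+ 1# (- Q) 0)
    (≡.cong (λ c → ℤ.1ℤ ℤ.+ c) (≡.trans (coeff-neg Q 0) (≡.cong ℤ.-_ Q₀≡0)))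

choose-> : ∀ {n k} Q → n ℕ.< k → [ n choose k ]⟨ Q ⟩ ≡ 0#
choose-> {n} {k} Q n<k rewrite dec-false (k ℕ.≤? n) (ℕ.<⇒≱ n<k) = ≡.refl

-- By `binom-product` the recursive binomial is an exact cofactor of the denominator, whose constant
-- coefficient is 1 because Q has constant coefficient 0; long division must therefore return it.
choose≈binom : ∀ Q → coeffq Q 0 ≡ ℤ.0ℤ → ∀ n k →
               [ n choose k ]⟨ Q ⟩ ≈ GaussianBinomial.binom ℤ[q]-ring Q n k
choose≈binom Q Q₀≡0 n k with k ℕ.≤? n
... | no k≰n = λ i → ≡.trans
  (≡.cong (λ p → coeffq p i) (choose-> Q (ℕ.≰⇒> k≰n)))
  (≡.sym (GaussianBinomial.binom-< ℤ[q]-ring Q n k (ℕ.≰⇒> k≰n) i))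
... | yes k≤n = λ i → ≡.trans
  (≡.cong (λ p → coeffq p i) choose≡)
  (÷-correct (sumTo _*_ 1# k N) (sumTo _*_ 1# k D) (binom n k)
    (square≡1 (coeff-∏≡1 k D (λ i → coeff-1-^ Q i Q₀≡0))) D*binom≈N i)
  where
  open GaussianBinomial ℤ[q]-ring Q
  D N : ℕ → ℤ[q]
  D i = 1# - Q ^ suc i
  N i = 1# - Q ^ ((n ℕ.∸ k) ℕ.+ suc i)
  D*binom≈N : sumTo _*_ 1# k D * binom n k ≈ sumTo _*_ 1# k N
  D*binom≈N = ≡.subst (λ m → sumTo _*_ 1# k D * binom m k ≈ sumTo _*_ 1# k N) (ℕ.m∸n+n≡m k≤n)
    (binom-product (n ℕ.∸ k) k)
  choose≡ : [ n choose k ]⟨ Q ⟩ ≡ sumTo _*_ 1# k N ÷ sumTo _*_ 1# k D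
  choose≡ rewrite dec-true (k ℕ.≤? n) k≤n =
    ≡.sym (≡.cong₂ _÷_ (sumTo≡foldr _*_ 1# k N) (sumTo≡foldr _*_ 1# k D))

*≡-1⇒square≡1 : ∀ a b → a ℤ.* b ≡ ℤ.-1ℤ → b ℤ.* b ≡ ℤ.1ℤ
*≡-1⇒square≡1 a b ab≡-1 = unit b (ℕ.m*n≡1⇒n≡1 ℤ.∣ a ∣ ℤ.∣ b ∣
  (≡.trans (≡.sym (ℤ.abs-* a b)) (≡.cong ℤ.∣_∣ ab≡-1)))
  where
  unit : ∀ b → ℤ.∣ b ∣ ≡ 1 → b ℤ.* b ≡ ℤ.1ℤ
  unit (ℤ.+ 1)  _ = ≡.refl
  unit -[1+ 0 ] _ = ≡.refl

coeff-q^d-1 : ∀ d → 0 ℕ.< d → coeffq (q ^ d - 1#) 0 ≡ ℤ.-1ℤ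
coeff-q^d-1 (suc d) _ = ≡.trans (coeff-+ (q ^ suc d) (- 1#) 0)
  (≡.cong (λ c → c ℤ.+ ℤ.-1ℤ) (coeff-*-zero q (q ^ d)))

-- The constant coefficient of q ^ d - 1 is -1, so that of any divisor is a unit of ℤ.
divisor-unit : ∀ d f → 0 ℕ.< d → f ∣ (q ^ d - 1#) → coeffq f 0 ℤ.* coeffq f 0 ≡ ℤ.1ℤ
divisor-unit d f 0<d (h , hf≈) = *≡-1⇒square≡1 (coeffq h 0) (coeffq f 0)
  (≡.trans (≡.sym (coeff-*-zero h f)) (≡.trans (hf≈ 0) (coeff-q^d-1 d 0<d)))

-- The case n = 0 of `scalar-∣-cofactor`: being divisible by 0 means being 0.
q^d-1-regular : ∀ d → 0 ℕ.< d → ∀ a → (q ^ d - 1#) * a ≈ 0# → a ≈ 0#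
q^d-1-regular d 0<d a e = proj₂ (scalar-∣-cofactor (q ^ d - 1#) ℤ.0ℤ [] a
  (divisor-unit d (q ^ d - 1#) 0<d (1# , ℤ[q].*-identityˡ (q ^ d - 1#))) e)

coeff-∑-const : ∀ n a i → coeffq (∑ n (λ _ → a)) i ≡ ℤ.+ n ℤ.* coeffq a i
coeff-∑-const zero    a i = ≡.sym (ℤ.*-zeroˡ (coeffq a i))
coeff-∑-const (suc n) a i = begin
  coeffq (a + ∑ n (λ _ → a)) i            ≡⟨ coeff-+ a _ i ⟩
  coeffq a i ℤ.+ coeffq (∑ n (λ _ → a)) i ≡⟨ ≡.cong (λ c → coeffq a i ℤ.+ c) (coeff-∑-const n a i) ⟩
  coeffq a i ℤ.+ ℤ.+ n ℤ.* coeffq a i     ≡⟨ ℤ.suc-* (ℤ.+ n) (coeffq a i) ⟨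
  ℤ.+ suc n ℤ.* coeffq a i                ∎
  where open ≡.≡-Reasoning

-- If u f is n + 1 times a, then n + 1 divides every coefficient of the cofactor u, because f is
-- invertible as a power series; the integer is then cancelled in ℤ.
torsion-free : ∀ d f → 0 ℕ.< d → f ∣ (q ^ d - 1#) → ∀ n a → f ∣ ∑ (suc n) (λ _ → a) → f ∣ a
torsion-free d f 0<d f∣ n a (u , uf≈na) with
  scalar-∣-cofactor f (ℤ.+ suc n) a u (divisor-unit d f 0<d f∣)
    (λ i → ≡.trans (*ₚ-comm f u i) (≡.trans (uf≈na i) (coeff-∑-const (suc n) a i)))
... | h Σ., u≈nh = h , λ i → ℤ.*-cancelˡ-≡ (ℤ.+ suc n) _ _ (begin
  ℤ.+ suc n ℤ.* coeffq (h * f) i        ≡⟨ •-*-assoc (ℤ.+ suc n) h f i ⟨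
  coeffq ((ℤ.+ suc n •ₚ h) * f) i
    ≡⟨ *ₚ-cong (ℤ.+ suc n •ₚ h) u f f (λ j → ≡.trans (coeff-• (ℤ.+ suc n) h j) (≡.sym (u≈nh j))) (λ _ → ≡.refl) i ⟩
  coeffq (u * f) i                      ≡⟨ uf≈na i ⟩
  coeffq (∑ (suc n) (λ _ → a)) i        ≡⟨ coeff-∑-const (suc n) a i ⟩
  ℤ.+ suc n ℤ.* coeffq a i              ∎)
  where open ≡.≡-Reasoning

-- Unfolding `Φ d` leaves its factors with fuel d - 1, whereas `Φ e` has fuel e. The recursion
-- descends to proper divisors only, so any fuel from d upwards gives the same result.
cyclotomic-fuel : ∀ m n d → 0 ℕ.< d → d ℕ.≤ m → d ℕ.≤ n → cyclotomic m d ≡ cyclotomic n d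
cyclotomic-fuel zero    n       (suc d) _   ()  _
cyclotomic-fuel (suc m) zero    (suc d) _   _   ()
cyclotomic-fuel (suc m) (suc n) d       0<d d≤m d≤n =
  ≡.cong (λ ps → (q ^ d - 1#) ÷ foldr _*_ 1# ps) (List.map-cong-local
    (All.map (λ { {e} (e<d Σ., 0<e Σ., _) → cyclotomic-fuel m n e 0<e
                    (ℕ.≤-pred (ℕ.≤-trans e<d d≤m)) (ℕ.≤-pred (ℕ.≤-trans e<d d≤n)) })
      (all-properDivisors d)))

Φ≡÷ : ∀ d → 0 ℕ.< d → Φ d ≡ (q ^ d - 1#) ÷ ∏Φ (properDivisors d)
Φ≡÷ (suc d) _ = ≡.cong (λ ps → (q ^ suc d - 1#) ÷ foldr _*_ 1# ps) (List.map-cong-local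
  (All.map (λ { {e} (e<d Σ., 0<e Σ., _) → cyclotomic-fuel d e e 0<e (ℕ.≤-pred e<d) ℕ.≤-refl })
    (all-properDivisors (suc d))))

Φ-factor : ∀ d → 0 ℕ.< d → ∏Φ (properDivisors d) ∣ (q ^ d - 1#) →
           Φ d * ∏Φ (properDivisors d) ≈ q ^ d - 1#
Φ-factor d 0<d P∣@(h , hP≈) i = ≡.trans
  (*ₚ-cong (Φ d) h P P (λ j → ≡.trans (≡.cong (λ p → coeffq p j) (Φ≡÷ d 0<d))
    (÷-correct (q ^ d - 1#) P h (divisor-unit d P 0<d P∣) (λ k → ≡.trans (*ₚ-comm P h k) (hP≈ k)) j))
    (λ _ → ≡.refl) i)
  (hP≈ i)
  where P = ∏Φ (properDivisors d)

-- Coefficients in x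

private module ℤ[x,q] = PolynomialRing ℤ[q]-ring

coeffx-∑ : ∀ n (F : ℕ → ℤ[x,q]) i → coeffx (sumBelow n F) i ≈ ∑ n (λ k → coeffx (F k) i)
coeffx-∑ zero    F i = ℤ[q].refl {0#}
coeffx-∑ (suc n) F i = ℤ[q].trans {coeffx (sumBelow (suc n) F) i} {coeffx (F 0) i + coeffx (sumBelow n (λ k → F (suc k))) i} {∑ (suc n) (λ k → coeffx (F k) i)}
  (ℤ[x,q].coeff-+ (F 0) _ i)
  (ℤ[q].+-congˡ {coeffx (F 0) i} {coeffx (sumBelow n (λ k → F (suc k))) i} {∑ n (λ k → coeffx (F (suc k)) i)}
    (coeffx-∑ n (λ k → F (suc k)) i))

coeffx-x^ : ∀ k i → coeffx (x ^ₓ k) i ≈ δ k i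
coeffx-x^ zero    zero    = ℤ[q].refl {1#}
coeffx-x^ zero    (suc i) = ℤ[q].refl {0#}
coeffx-x^ (suc k) i       = begin
  coeffx (x *ₓ x ^ₓ k) i                                     ≈⟨ ℤ[x,q].coeff-∷-* 0# 1ₓ (x ^ₓ k) i ⟩
  0# * coeffx (x ^ₓ k) i + coeffx (0# ∷ (1ₓ *ₓ x ^ₓ k)) i    ≈⟨ ℤ[q].+-identityˡ (coeffx (0# ∷ (1ₓ *ₓ x ^ₓ k)) i) ⟩
  coeffx (0# ∷ (1ₓ *ₓ x ^ₓ k)) i                             ≈⟨ shifted i ⟩
  δ (suc k) i                                                ∎
  where
  open SetoidReasoning ℤ[q].setoid
  shifted : ∀ i → coeffx (0# ∷ (1ₓ *ₓ x ^ₓ k)) i ≈ δ (suc k) i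
  shifted zero    = ℤ[q].refl {0#}
  shifted (suc i) = ℤ[q].trans {coeffx (1ₓ *ₓ x ^ₓ k) i} {coeffx (x ^ₓ k) i} {δ k i}
    (ℤ[x,q].*ₚ-identityˡ (x ^ₓ k) i) (coeffx-x^ k i)

coeffx-∑-x^ : ∀ n (f : ℕ → ℤ[q]) i →
              coeffx (sumBelow n (λ k → f k • x ^ₓ k)) i ≈ ∑ n (λ k → f k * δ k i)
coeffx-∑-x^ n f i = begin
  coeffx (sumBelow n (λ k → f k • x ^ₓ k)) i    ≈⟨ coeffx-∑ n (λ k → f k • x ^ₓ k) i ⟩
  ∑ n (λ k → coeffx (f k • x ^ₓ k) i)           ≈⟨ ∑-cong n {λ k → coeffx (f k • x ^ₓ k) i} {λ k → f k * δ k i} (λ k _ →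
    ℤ[q].trans {coeffx (f k • x ^ₓ k) i} {f k * coeffx (x ^ₓ k) i} {f k * δ k i}
      (ℤ[x,q].coeff-• (f k) (x ^ₓ k) i)
      (ℤ[q].*-congˡ {f k} {coeffx (x ^ₓ k) i} {δ k i} (coeffx-x^ k i))) ⟩
  ∑ n (λ k → f k * δ k i)                       ∎
  where open SetoidReasoning ℤ[q].setoid

-- Valid also for i > n, where [n choose i] vanishes. Thus all terms of a sum over k share one
-- formula, whatever the degree of the k-th polynomial.
coeffx-g : ∀ n Q i →
  coeffx (g n Q) i ≈ [ n choose i ]⟨ Q ⟩ ^ 2 * [ 2 ℕ.* i choose i ]⟨ Q ⟩
coeffx-g n Q i with i ℕ.<? suc n
... | yes i<1+n = ℤ[q].trans {coeffx (g n Q) i} {∑ (suc n) (λ k → f k * δ k i)} {f i}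
  (coeffx-∑-x^ (suc n) f i) (∑-δ-< (suc n) i f i<1+n)
  where f = λ k → [ n choose k ]⟨ Q ⟩ ^ 2 * [ 2 ℕ.* k choose k ]⟨ Q ⟩
... | no i≮1+n rewrite choose-> {n} {i} Q (ℕ.≮⇒≥ i≮1+n) =
  ℤ[q].trans {coeffx (g n Q) i} {∑ (suc n) (λ k → f k * δ k i)} {0#}
    (coeffx-∑-x^ (suc n) f i) (∑-δ-≥ (suc n) i f (ℕ.≮⇒≥ i≮1+n))
  where f = λ k → [ n choose k ]⟨ Q ⟩ ^ 2 * [ 2 ℕ.* k choose k ]⟨ Q ⟩

coeffx-∑-g : ∀ n Q (w : ℕ → ℤ[q]) i → coeffx (sumBelow n (λ k → w k • g k Q)) i
  ≈ ∑ n (λ k → w k * ([ k choose i ]⟨ Q ⟩ ^ 2 * [ 2 ℕ.* i choose i ]⟨ Q ⟩))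
coeffx-∑-g n Q w i = begin
  coeffx (sumBelow n (λ k → w k • g k Q)) i    ≈⟨ coeffx-∑ n (λ k → w k • g k Q) i ⟩
  ∑ n (λ k → coeffx (w k • g k Q) i)           ≈⟨ ∑-cong n {λ k → coeffx (w k • g k Q) i} {λ k → w k * c k} (λ k _ →
    ℤ[q].trans {coeffx (w k • g k Q) i} {w k * coeffx (g k Q) i} {w k * c k}
      (ℤ[x,q].coeff-• (w k) (g k Q) i)
      (ℤ[q].*-congˡ {w k} {coeffx (g k Q) i} {c k} (coeffx-g k Q i))) ⟩
  ∑ n (λ k → w k * c k)                        ∎
  where
  open SetoidReasoning ℤ[q].setoid
  c : ℕ → ℤ[q]
  c k = [ k choose i ]⟨ Q ⟩ ^ 2 * [ 2 ℕ.* i choose i ]⟨ Q ⟩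

-- Used with a summand containing [k choose j], which is zero for k < j: the inner sum may start at
-- 0 and so covers whole periods.
sumFromTo≈∑ : ∀ j n (f : ℕ → ℤ[q]) → j ℕ.≤ n → (∀ k → k ℕ.< j → f k ≈ 0#) →
              sumFromTo j n f ≈ ∑ n f
sumFromTo≈∑ j n f j≤n f≈0 i = begin
  coeffq (sumFromTo j n f) i
    ≡⟨ ≡.cong (λ p → coeffq p i) (sumTo≡foldr _+_ 0# (n ℕ.∸ j) (λ k → f (j ℕ.+ k))) ⟨
  coeffq (∑ (n ℕ.∸ j) (λ k → f (j ℕ.+ k))) i        ≡⟨ ∑-leading-zeros j (n ℕ.∸ j) f f≈0 i ⟨
  coeffq (∑ (j ℕ.+ (n ℕ.∸ j)) f) i                  ≡⟨ ≡.cong (λ m → coeffq (∑ m f) i) (ℕ.m+[n∸m]≡n j≤n) ⟩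
  coeffq (∑ n f) i                                  ∎
  where open ≡.≡-Reasoning

∣-respʳ : ∀ {m} a b → a ≈ b → m ∣ a → m ∣ b
∣-respʳ a b a≈b (u , um≈a) = u , λ i → ≡.trans (um≈a i) (a≈b i)

+0ₓ : ∀ F i → coeffx F i ≈ coeffx (F +ₓ (-ₓ 0ₓ)) i
+0ₓ F i = ℤ[q].sym {coeffx (F +ₓ (-ₓ 0ₓ)) i} {coeffx F i} (ℤ[x,q].+ₚ-identityʳ F i)

-- The three congruences

weighted-congruence : ∀ n →
  (1# + q) ^ 2 • (∑ₓ[ k < n ] (q ^ (2 ℕ.* k) * [ suc k ]⟨ q ^ 2 ⟩) • g k (q ^ 2))
  ≡ (∑ₓ[ k < n ] q ^ (2 ℕ.* k) • g k (q ^ 2))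
  mod ∏Φ (filter (λ d → (1 <? d) ×-dec ¬? (2 ∣? d)) (divisors n))
weighted-congruence n j = ∣-respʳ
  ((1# + q) ^ 2 * ∑ n (λ k → w′ k * c k) - ∑ n (λ k → w k * c k)) (coeffx ((1# + q) ^ 2 • F +ₓ (-ₓ G)) j)
  (begin
    (1# + q) ^ 2 * ∑ n (λ k → w′ k * c k) - ∑ n (λ k → w k * c k)
      ≈⟨ ℤ[q].+-cong {(1# + q) ^ 2 * ∑ n (λ k → w′ k * c k)} {(1# + q) ^ 2 * coeffx F j} { - ∑ n (λ k → w k * c k)} { - coeffx G j}
           (ℤ[q].*-congˡ {(1# + q) ^ 2} {∑ n (λ k → w′ k * c k)} {coeffx F j}
             (ℤ[q].sym {coeffx F j} {∑ n (λ k → w′ k * c k)} (coeffx-∑-g n Q w′ j)))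
           (ℤ[q].-‿cong {∑ n (λ k → w k * c k)} {coeffx G j}
             (ℤ[q].sym {coeffx G j} {∑ n (λ k → w k * c k)} (coeffx-∑-g n Q w j))) ⟩
    (1# + q) ^ 2 * coeffx F j - coeffx G j
      ≈⟨ ℤ[q].+-cong {coeffx ((1# + q) ^ 2 • F) j} {(1# + q) ^ 2 * coeffx F j} {coeffx (-ₓ G) j} { - coeffx G j}
           (ℤ[x,q].coeff-• ((1# + q) ^ 2) F j) (ℤ[x,q].coeff-neg G j) ⟨
    coeffx ((1# + q) ^ 2 • F) j + coeffx (-ₓ G) j
      ≈⟨ ℤ[x,q].coeff-+ ((1# + q) ^ 2 • F) (-ₓ G) j ⟨
    coeffx ((1# + q) ^ 2 • F +ₓ (-ₓ G)) j ∎)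
  (CyclotomicFactors.∏∣weighted-sums ℤ[q]-ring q Φ Φ-factor torsion-free q^d-1-regular
      w (λ n k → [ n choose k ]⟨ Q ⟩)
    (λ k → ℤ[q].sym {Q ^ k} {q ^ (2 ℕ.* k)} (SemiringExp.^-assocʳ ℤ[q].semiring q 2 k)) (choose≈binom Q ≡.refl)
    (λ k → [ suc k ]⟨ Q ⟩) (λ k → q-integer-correct Q (suc k) ≡.refl) n j)
  where
  open SetoidReasoning ℤ[q].setoid
  Q : ℤ[q]
  Q = q ^ 2
  w w′ c : ℕ → ℤ[q]
  w k = q ^ (2 ℕ.* k)
  w′ k = w k * [ suc k ]⟨ Q ⟩
  c k = [ k choose j ]⟨ Q ⟩ ^ 2 * [ 2 ℕ.* j choose j ]⟨ Q ⟩
  F = ∑ₓ[ k < n ] w′ k • g k Q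
  G = ∑ₓ[ k < n ] w k • g k Q

plain-congruence : ∀ n →
  (∑ₓ[ k < n ] q ^ k • g k q) ≡ 0ₓ mod ∏Φ (filter (2 ∣?_) (divisors n))
plain-congruence n j = ∣-respʳ (∑ n (λ k → q ^ k * c k)) (coeffx (F +ₓ (-ₓ 0ₓ)) j)
  (begin
    ∑ n (λ k → q ^ k * c k)        ≈⟨ coeffx-∑-g n q (q ^_) j ⟨
    coeffx F j                     ≈⟨ +0ₓ F j ⟩
    coeffx (F +ₓ (-ₓ 0ₓ)) j        ∎)
  (CyclotomicFactors.∏∣sum-B² ℤ[q]-ring q Φ Φ-factor torsion-free q^d-1-regular
      (q ^_) (λ n k → [ n choose k ]⟨ q ⟩)
    (λ k → ℤ[q].refl {q ^ k}) (choose≈binom q ≡.refl) n j)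
  where
  open SetoidReasoning ℤ[q].setoid
  c : ℕ → ℤ[q]
  c k = [ k choose j ]⟨ q ⟩ ^ 2 * [ 2 ℕ.* j choose j ]⟨ q ⟩
  F = ∑ₓ[ k < n ] q ^ k • g k q

mixed-congruence : ∀ n →
  (∑ₓ[ j < n ]
     ( [ suc j ]⟨ q ^ 2 ⟩ * [ 2 ℕ.* j choose j ]⟨ q ⟩
       * (∑[ j ≤ k < n ] q ^ k * [ k choose j ]⟨ q ⟩ * [ suc k choose suc j ]⟨ q ⟩) )
     • x ^ₓ j)
  ≡ 0ₓ mod ∏Φ (filter (λ d → (2 <? d) ×-dec (2 ∣? d)) (divisors n))
mixed-congruence n j with j ℕ.<? n
-- The outer sum stops before x ^ j, so this coefficient is zero.
... | no j≮n = 0# , (begin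
  0#                          ≈⟨ ∑-δ-≥ n j c (ℕ.≮⇒≥ j≮n) ⟨
  ∑ n (λ k → c k * δ k j)     ≈⟨ coeffx-∑-x^ n c j ⟨
  coeffx F j                  ≈⟨ +0ₓ F j ⟩
  coeffx (F +ₓ (-ₓ 0ₓ)) j     ∎)
  where
  open SetoidReasoning ℤ[q].setoid
  Q : ℤ[q]
  Q = q ^ 2
  c : ℕ → ℤ[q]
  c j = [ suc j ]⟨ Q ⟩ * [ 2 ℕ.* j choose j ]⟨ q ⟩
        * (∑[ j ≤ k < n ] q ^ k * [ k choose j ]⟨ q ⟩ * [ suc k choose suc j ]⟨ q ⟩)
  F = ∑ₓ[ k < n ] c k • x ^ₓ k
... | yes j<n = ∣-respʳ (a * ∑ n t) (coeffx (F +ₓ (-ₓ 0ₓ)) j)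
  (begin
    a * ∑ n t                   ≈⟨ ℤ[q].*-congˡ {a} {sumFromTo j n t} {∑ n t} (sumFromTo≈∑ j n t (ℕ.<⇒≤ j<n) t≈0) ⟨
    c j                         ≈⟨ ∑-δ-< n j c j<n ⟨
    ∑ n (λ k → c k * δ k j)     ≈⟨ coeffx-∑-x^ n c j ⟨
    coeffx F j                  ≈⟨ +0ₓ F j ⟩
    coeffx (F +ₓ (-ₓ 0ₓ)) j     ∎)
  (CyclotomicFactors.∏∣mixed-sum ℤ[q]-ring q Φ Φ-factor torsion-free q^d-1-regular
      (q ^_) (λ n k → [ n choose k ]⟨ q ⟩)
    (λ k → ℤ[q].refl {q ^ k}) (choose≈binom q ≡.refl) n j
    [ suc j ]⟨ Q ⟩ (q-integer-correct Q (suc j) ≡.refl))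
  where
  open SetoidReasoning ℤ[q].setoid
  Q : ℤ[q]
  Q = q ^ 2
  a : ℤ[q]
  a = [ suc j ]⟨ Q ⟩ * [ 2 ℕ.* j choose j ]⟨ q ⟩
  c : ℕ → ℤ[q]
  c j = [ suc j ]⟨ Q ⟩ * [ 2 ℕ.* j choose j ]⟨ q ⟩
        * (∑[ j ≤ k < n ] q ^ k * [ k choose j ]⟨ q ⟩ * [ suc k choose suc j ]⟨ q ⟩)
  F = ∑ₓ[ k < n ] c k • x ^ₓ k
  t : ℕ → ℤ[q]
  t k = q ^ k * [ k choose j ]⟨ q ⟩ * [ suc k choose suc j ]⟨ q ⟩
  t≈0 : ∀ k → k ℕ.< j → t k ≈ 0#
  t≈0 k k<j rewrite choose-> {k} {j} q k<j =
    ℤ[q].*-congʳ {[ suc k choose suc j ]⟨ q ⟩} {q ^ k * 0#} {0#} (ℤ[q].zeroʳ (q ^ k))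

theorem5 :
    (n : ℕ) .{{_ : NonZero n}} →
    ( (1# + q) ^ 2 • (∑ₓ[ k < n ] (q ^ (2 ℕ.* k) * [ suc k ]⟨ q ^ 2 ⟩) • g k (q ^ 2))
      ≡ (∑ₓ[ k < n ] q ^ (2 ℕ.* k) • g k (q ^ 2))
      mod ∏Φ (filter (λ d → (1 <? d) ×-dec ¬? (2 ∣? d)) (divisors n)) )
    ×
    ( (∑ₓ[ k < n ] q ^ k • g k q)
      ≡ 0ₓ
      mod ∏Φ (filter (2 ∣?_) (divisors n)) )
    ×
    ( (∑ₓ[ j < n ]
         ( [ suc j ]⟨ q ^ 2 ⟩ * [ 2 ℕ.* j choose j ]⟨ q ⟩
           * (∑[ j ≤ k < n ] q ^ k * [ k choose j ]⟨ q ⟩ * [ suc k choose suc j ]⟨ q ⟩) )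
         • x ^ₓ j)
      ≡ 0ₓ
      mod ∏Φ (filter (λ d → (2 <? d) ×-dec (2 ∣? d)) (divisors n)) )
theorem5 n = weighted-congruence n Σ., plain-congruence n Σ., mixed-congruence n
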